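{- Let $k\ge 3$ be an integer and let $K>0$ be real. Then there is a finite poset $P$ with $e(P)=k$ and $\pi^-(P)>K$. Explicitly, for any integer $L>2K$ and $m=2^{L^2}+1$, one may take $P$ to be the poset obtained from $S_2(m,0)$ by adjoining a chain of $k-2$ new elements below its unique minimum.
   Context: For $m\ge2$, $S_2(m,0)=\{X\subseteq[m]:|X|\le2\}$, ordered by inclusion; its unique minimum is $\varnothing$. A family $\mathcal G$ of sets is a weak copy of a finite poset $(P,\leqslant)$ if there is a bijection $\psi:P\to\mathcal G$ such that $\psi(p)\subseteq\psi(p')$ whenever $p\leqslant p'$. A family $\mathcal F$ is (weak) $P$-free if no subfamily of it is a weak copy of $P$. $\mathrm{La}(n,P)$ is the maximum size of a weak $P$-free family $\mathcal F\subseteq 2^{[n]}$, where $[n]=\{1,\dots,n\}$, and $\pi^-(P)=\liminf_{n\to\infty}\mathrm{La}(n,P)/\binom{n}{\lfloor n/2\rfloor}$. $e(P)$ is the maximum integer $k$ such that, for every $n$, the union of any $k$ consecutive layers of $2^{[n]}$ is weak $P$-free; a layer of $2^{[n]}$ is $\binom{[n]}{s}=\{Y\subseteq[n]:|Y|=s\}$. -}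

module Defs where

open import Data.Bool.Base using (true; false)
open import Data.Fin.Base using (Fin; zero; suc; toℕ; combine)
import Data.Fin.Properties as Fin
open import Data.Fin.Subset using (Subset; inside; outside; _⊆_; ∣_∣; ⊥)
open import Data.Fin.Subset.Properties
  using (anySubset?; _⊆?_; ⊆-poset; ⊆-antisym; ∣⊥∣≡0)
open import Data.Integer.Base using (+_)
open import Data.List.Base as List using (List; []; _∷_; length; allFin; map; _++_)
open import Data.List.Membership.Propositional using (_∈_)
open import Data.List.Membership.Propositional.Properties
  using (∈-lookup; ∈-allFin; ∈-map⁺; ∈-++⁺ˡ; ∈-++⁺ʳ)
open import Data.List.Relation.Unary.All as All using ()
open import Data.List.Relation.Unary.AllPairs as AllPairs using ()
open import Data.List.Relation.Unary.Any as Any using (Any; here; there)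
open import Data.List.Relation.Unary.Any.Properties using (lookup-index)
open import Data.List.Relation.Unary.Enumerates.Setoid using (IsEnumeration)
import Data.List.Relation.Unary.Enumerates.Setoid.Properties as Enum
open import Data.List.Relation.Unary.Unique.Propositional using (Unique)
open import Data.Nat.Base
  using (ℕ; zero; suc; _+_; _^_; _∸_; _≤_; _<_; z≤n; ⌊_/2⌋; NonZero; >-nonZero)
open import Data.Nat.Combinatorics using (_C_; nCk≡n!/k![n-k]!; k![n∸k]!∣n!)
open import Data.Nat.DivMod using (m≥n⇒m/n>0)
open import Data.Nat.Divisibility using (∣⇒≤)
import Data.Nat.Properties as ℕ
open import Data.Product.Base using (Σ; ∃; _×_; _,_; proj₁; proj₂)
open import Data.Rational.Base as ℚ using (ℚ)
open import Data.Sum.Base using (_⊎_; inj₁; inj₂)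
open import Data.Sum.Relation.Binary.LeftOrder using (⊎-<-poset; ⊎-<-decidable)
open import Data.Vec.Base as Vec using (Vec; []; _∷_)
import Data.Vec.Properties as Vec
open import Data.Bool.Properties using () renaming (_≟_ to _≟ᵇ_)
open import Function.Base using (_∘_)
open import Function.Bundles using (Bijection)
open import Level using (0ℓ) renaming (suc to lsuc)
open import Relation.Binary.Bundles using (Poset; Setoid)
import Relation.Binary.Construct.On as On
import Relation.Binary.Definitions as B
open import Relation.Binary.PropositionalEquality
  using (_≡_; refl; sym; trans; cong; subst; setoid)
open import Relation.Nullary using (¬_; Dec; yes; no; ¬?; contradiction)
open import Relation.Nullary.Decidable using (map′; _×-dec_; _→-dec_)
open import Relation.Unary using (Pred; Decidable; ⋃) renaming (_⊆_ to _⊑_)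

IsMaximum : ∀ {ℓ} → Pred ℕ ℓ → Pred ℕ ℓ
IsMaximum Q v = Q v × (∀ w → Q w → w ≤ v)

-- Decidability of the order holds for every finite poset classically; it is
-- what makes La below a total function.  The empty poset is excluded because
-- it has a copy in every family, so that neither La nor e is defined for it.
record FinitePoset : Set₁ where
  field
    poset    : Poset 0ℓ 0ℓ 0ℓ
  open Poset poset public
    using (Carrier; _≈_; module Eq; reflexive; antisym)
    renaming (_≤_ to _≼_; trans to ≼-trans)
  field
    _≼?_     : B.Decidable _≼_
    elements : List Carrier
    complete : IsEnumeration Eq.setoid elements
    point    : Carrier

Family : ℕ → Set₁
Family n = Pred (Subset n) 0ℓ

members : ∀ {n} → Family n → Setoid 0ℓ 0ℓ
members {n} G = On.setoid {B = Σ (Subset n) G} (setoid (Subset n)) proj₁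

record WeakCopy (P : FinitePoset) {n : ℕ} (G : Family n) : Set where
  open FinitePoset P
  field
    ψ        : Bijection Eq.setoid (members G)
    monotone : ∀ {p p′} → p ≼ p′ →
               proj₁ (Bijection.to ψ p) ⊆ proj₁ (Bijection.to ψ p′)

WeakFree : FinitePoset → ∀ {n} → Family n → Set₁
WeakFree P {n} F = ¬ (∃ λ (G : Family n) → (G ⊑ F) × WeakCopy P G)

Layer : ∀ n → ℕ → Family n
Layer n s Y = ∣ Y ∣ ≡ s

-- The layers s, s + 1, …, s + k - 1; all of them are layers of 2^[n] when
-- s + k ≤ n + 1.
Layers : ∀ n → ℕ → ℕ → Family n
Layers n s k = ⋃ (Fin k) λ i → Layer n (s + toℕ i)

e_is_ : FinitePoset → ℕ → Set₁
e P is k = IsMaximum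
  (λ j → ∀ n s → s + j ≤ suc n → WeakFree P (Layers n s j)) k

IsFreeSize : FinitePoset → ℕ → ℕ → Set₁
IsFreeSize P n v =
  ∃ λ (F : List (Subset n)) → Unique F × WeakFree P (_∈ F) × length F ≡ v

private

  any-vec? : ∀ {ℓ} {A : Set} →
             (∀ {Q : Pred A ℓ} → Decidable Q → Dec (∃ Q)) →
             ∀ p {Q : Pred (Vec A p) ℓ} → Decidable Q → Dec (∃ Q)
  any-vec? ex zero    Q? = map′ ([] ,_) (λ { ([] , q) → q }) (Q? [])
  any-vec? ex (suc p) Q? =
    map′ (λ { (x , xs , q) → x ∷ xs , q }) (λ { (x ∷ xs , q) → x , xs , q })
         (ex λ x → any-vec? ex p λ xs → Q? (x ∷ xs))

  _≟ˢ_ : ∀ {n} → B.DecidableEquality (Subset n)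
  _≟ˢ_ = Vec.≡-dec _≟ᵇ_

  module _ (P : FinitePoset) where
    open FinitePoset P

    size : ℕ
    size = length elements

    el : Fin size → Carrier
    el = List.lookup elements

    idx : Carrier → Fin size
    idx x = Any.index (complete x)

    el-idx : ∀ x → x ≈ el (idx x)
    el-idx x = lookup-index (complete x)

    _≈?_ : B.Decidable _≈_
    x ≈? y = map′ (λ (p , q) → antisym p q)
                  (λ eq → reflexive eq , reflexive (Eq.sym eq))
                  ((x ≼? y) ×-dec (y ≼? x))

    Table : ∀ {n} → Family n → Vec (Subset n) size → Set
    Table F v =
      (∀ i → F (Vec.lookup v i)) ×
      (∀ i j → (el i ≼ el j → Vec.lookup v i ⊆ Vec.lookup v j) ×
               (Vec.lookup v i ≡ Vec.lookup v j → el i ≈ el j))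

    table? : ∀ {n} {F : Family n} → Decidable F → Decidable (Table F)
    table? F? v =
      Fin.all? (λ i → F? (Vec.lookup v i)) ×-dec
      Fin.all? (λ i → Fin.all? λ j →
        ((el i ≼? el j) →-dec (Vec.lookup v i ⊆? Vec.lookup v j)) ×-dec
        ((Vec.lookup v i ≟ˢ Vec.lookup v j) →-dec (el i ≈? el j)))

    module _ {n} {F : Family n} where

      fromTable : ∃ (Table F) → ∃ λ (G : Family n) → (G ⊑ F) × WeakCopy P G
      fromTable (v , inF , tab) = G , G⊑F , record
        { ψ = record
          { to        = λ x → at (idx x) , idx x , refl
          ; cong      = λ {x} {y} x≈y → at-cong
                          (Eq.trans (Eq.sym (el-idx x)) (Eq.trans x≈y (el-idx y)))
          ; bijective =
              (λ {x} {y} eq → Eq.trans (el-idx x)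
                 (Eq.trans (proj₂ (tab (idx x) (idx y)) eq) (Eq.sym (el-idx y))))
            , (λ (X , i , eq) → el i , λ {z} z≈ → trans
                 (at-cong (Eq.trans (Eq.sym (el-idx z)) z≈)) eq)
          }
        ; monotone = λ {x} {y} x≼y → proj₁ (tab (idx x) (idx y))
            (≼-trans (reflexive (Eq.sym (el-idx x)))
              (≼-trans x≼y (reflexive (el-idx y))))
        }
        where
        at : Fin size → Subset n
        at = Vec.lookup v
        G : Family n
        G X = ∃ λ i → at i ≡ X
        G⊑F : G ⊑ F
        G⊑F (i , refl) = inF i
        at-cong : ∀ {i j} → el i ≈ el j → at i ≡ at j
        at-cong {i} {j} eq = ⊆-antisym (proj₁ (tab i j) (reflexive eq))
                                       (proj₁ (tab j i) (reflexive (Eq.sym eq)))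

      toTable : (∃ λ (G : Family n) → (G ⊑ F) × WeakCopy P G) → ∃ (Table F)
      toTable (G , G⊑F , copy) = Vec.tabulate f
        , (λ i → subst F (sym (look i)) (G⊑F (proj₂ (to (el i)))))
        , (λ i j → mono i j , inj i j)
        where
        open WeakCopy copy
        open Bijection ψ using (to; injective)
        f : Fin size → Subset n
        f = proj₁ ∘ to ∘ el
        look : ∀ i → Vec.lookup (Vec.tabulate f) i ≡ f i
        look = Vec.lookup∘tabulate f
        mono : ∀ i j → el i ≼ el j →
               Vec.lookup (Vec.tabulate f) i ⊆ Vec.lookup (Vec.tabulate f) j
        mono i j le rewrite look i | look j = monotone le
        inj : ∀ i j → Vec.lookup (Vec.tabulate f) i ≡ Vec.lookup (Vec.tabulate f) j →
              el i ≈ el j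
        inj i j eq rewrite look i | look j = injective eq

      weakFree? : Decidable F → Dec (WeakFree P F)
      weakFree? F? = ¬? (map′ fromTable toTable (any-vec? anySubset? size (table? F?)))

    isFreeSize? : ∀ n → Decidable (IsFreeSize P n)
    isFreeSize? n v = map′
      (λ { (xs , u , free) → Vec.toList xs , u , free , Vec.length-toList xs })
      (λ { (F , u , free , refl) →
           Vec.fromList F
         , subst (λ G → Unique G × WeakFree P (_∈ G))
                 (sym (Vec.toList∘fromList F)) (u , free) })
      (any-vec? anySubset₁? v λ xs →
        AllPairs.allPairs? (λ X Y → ¬? (X ≟ˢ Y)) (Vec.toList xs) ×-dec
        weakFree? (λ X → Any.any? (X ≟ˢ_) (Vec.toList xs)))
      where
      anySubset₁? : {Q : Pred (Subset n) (lsuc 0ℓ)} → Decidable Q → Dec (∃ Q)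
      anySubset₁? = anySubset?

  encode : ∀ {n} → Subset n → Fin (2 ^ n)
  encode []          = zero
  encode (false ∷ X) = combine {2} zero (encode X)
  encode (true  ∷ X) = combine {2} (suc zero) (encode X)

  encode-injective : ∀ {n} (X Y : Subset n) → encode X ≡ encode Y → X ≡ Y
  encode-injective []          []          _  = refl
  encode-injective (false ∷ X) (false ∷ Y) eq = cong (false ∷_) (encode-injective X Y
    (Fin.combine-injectiveʳ {2} zero (encode X) zero (encode Y) eq))
  encode-injective (true  ∷ X) (true  ∷ Y) eq = cong (true ∷_) (encode-injective X Y
    (Fin.combine-injectiveʳ {2} (suc zero) (encode X) (suc zero) (encode Y) eq))
  encode-injective (false ∷ X) (true  ∷ Y) eq
    with () ← Fin.combine-injectiveˡ {2} zero (encode X) (suc zero) (encode Y) eq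
  encode-injective (true  ∷ X) (false ∷ Y) eq
    with () ← Fin.combine-injectiveˡ {2} (suc zero) (encode X) zero (encode Y) eq

  lookup-injective : ∀ {A : Set} {xs : List A} → Unique xs → ∀ i j →
                     List.lookup xs i ≡ List.lookup xs j → i ≡ j
  lookup-injective (_ AllPairs.∷ _) zero    zero    _  = refl
  lookup-injective (p AllPairs.∷ _) zero    (suc j) eq =
    contradiction eq (All.lookup p (∈-lookup j))
  lookup-injective (p AllPairs.∷ _) (suc i) zero    eq =
    contradiction (sym eq) (All.lookup p (∈-lookup i))
  lookup-injective (_ AllPairs.∷ u) (suc i) (suc j) eq =
    cong suc (lookup-injective u i j eq)

  length≤ : ∀ {n} {F : List (Subset n)} → Unique F → length F ≤ 2 ^ n
  length≤ {F = F} u = Fin.injective⇒≤ {f = encode ∘ List.lookup F}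
    λ {i} {j} eq → lookup-injective u i j (encode-injective _ _ eq)

  maximum : ∀ {ℓ} {Q : Pred ℕ ℓ} → Decidable Q → Q 0 →
            ∀ b → (∀ w → Q w → w ≤ b) → ∃ (IsMaximum Q)
  maximum {Q = Q} Q? q₀ zero    ub = 0 , q₀ , ub
  maximum {Q = Q} Q? q₀ (suc b) ub with Q? (suc b)
  ... | yes q = suc b , q , ub
  ... | no ¬q = maximum Q? q₀ b λ w qw →
    ℕ.≤-pred (ℕ.≤∧≢⇒< (ub w qw) λ { refl → ¬q qw })

abstract
  maximumFreeSize : ∀ P n → ∃ (IsMaximum (IsFreeSize P n))
  maximumFreeSize P n = maximum (isFreeSize? P n)
    ([] , AllPairs.[] , empty-free , refl)
    (2 ^ n) (λ { w (F , u , _ , refl) → length≤ u })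
    where
    open FinitePoset P using (point)
    empty-free : WeakFree P {n} (_∈ [])
    empty-free (G , G⊑[] , copy)
      with () ← G⊑[] (proj₂ (Bijection.to (WeakCopy.ψ copy) point))

La : ℕ → FinitePoset → ℕ
La n P = proj₁ (maximumFreeSize P n)

La-isMaximum : ∀ n P → IsMaximum (IsFreeSize P n) (La n P)
La-isMaximum n P = proj₂ (maximumFreeSize P n)

nCk-nonZero : ∀ {n k} → k ≤ n → NonZero (n C k)
nCk-nonZero {n} {k} k≤n = >-nonZero (subst (0 <_) (sym (nCk≡n!/k![n-k]! k≤n))
  (m≥n⇒m/n>0 (∣⇒≤ (k![n∸k]!∣n! k≤n))))
  where instance _ = k ℕ.!* (n ∸ k) !≢0
                 _ = n ℕ.!≢0

ratio : FinitePoset → ℕ → ℚ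
ratio P n = + La n P ℚ./ (n C ⌊ n /2⌋)
  where instance _ = nCk-nonZero (ℕ.⌊n/2⌋≤n n)

-- Dedekind cuts of ℚ.
record ℝ : Set₁ where
  field
    lower upper   : Pred ℚ 0ℓ
    lower-inhab   : ∃ lower
    upper-inhab   : ∃ upper
    lower-closed  : ∀ {p q} → p ℚ.< q → lower q → lower p
    upper-closed  : ∀ {p q} → p ℚ.< q → upper p → upper q
    lower-rounded : ∀ {p} → lower p → ∃ λ q → p ℚ.< q × lower q
    upper-rounded : ∀ {q} → upper q → ∃ λ p → p ℚ.< q × upper p
    disjoint      : ∀ {q} → ¬ (lower q × upper q)
    located       : ∀ {p q} → p ℚ.< q → lower p ⊎ upper q

_<ℝ_ : ℚ → ℝ → Set
q <ℝ x = ℝ.lower x q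

_ℝ<_ : ℝ → ℚ → Set
x ℝ< q = ℝ.upper x q

-- A limit inferior, possibly infinite, represented by the set of rationals
-- below it: q < sup_N inf_{n ≥ N} a n  iff  q < r ≤ inf_{n ≥ N} a n for some
-- r and N.
LowerReal : Set₁
LowerReal = Pred ℚ 0ℓ

liminf : (ℕ → ℚ) → LowerReal
liminf a q = ∃ λ r → q ℚ.< r × ∃ λ N → ∀ n → N ≤ n → r ℚ.≤ a n

infix 4 _<ℝ_ _ℝ<_ _<ₗ_

_<ₗ_ : ℝ → LowerReal → Set
x <ₗ y = ∃ λ q → x ℝ< q × y q

π⁻ : FinitePoset → LowerReal
π⁻ P = liminf (ratio P)

private

  subsets : ∀ n → List (Subset n)
  subsets zero    = [] ∷ []
  subsets (suc n) = map (outside ∷_) (subsets n) ++ map (inside ∷_) (subsets n)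

  ∈-subsets : ∀ {n} (X : Subset n) → X ∈ subsets n
  ∈-subsets []          = here refl
  ∈-subsets (false ∷ X) = ∈-++⁺ˡ (∈-map⁺ (outside ∷_) (∈-subsets X))
  ∈-subsets {suc n} (true ∷ X) =
    ∈-++⁺ʳ (map (outside ∷_) (subsets n)) (∈-map⁺ (inside ∷_) (∈-subsets X))

  module _ {n} {G : Family n} (G? : Decidable G) where

    restrict : List (Subset n) → List (Σ (Subset n) G)
    restrict []       = []
    restrict (X ∷ Xs) with G? X
    ... | yes g = (X , g) ∷ restrict Xs
    ... | no  _ = restrict Xs

    ∈-restrict : ∀ {Xs} (Y : Σ (Subset n) G) → proj₁ Y ∈ Xs →
                 Any (λ Z → proj₁ Y ≡ proj₁ Z) (restrict Xs)
    ∈-restrict {X ∷ Xs} (Y , g) Y∈ with G? X | Y∈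
    ... | yes _ | here eq    = here eq
    ... | yes _ | there Y∈Xs = there (∈-restrict (Y , g) Y∈Xs)
    ... | no ¬g | here refl  = contradiction g ¬g
    ... | no  _ | there Y∈Xs = ∈-restrict (Y , g) Y∈Xs

S₂ : ℕ → FinitePoset
S₂ m = record
  { poset    = On.poset {B = Σ (Subset m) λ X → ∣ X ∣ ≤ 2} (⊆-poset m) proj₁
  ; _≼?_     = λ X Y → proj₁ X ⊆? proj₁ Y
  ; elements = restrict (λ X → ∣ X ∣ ℕ.≤? 2) (subsets m)
  ; complete = λ X → ∈-restrict (λ X → ∣ X ∣ ℕ.≤? 2) X (∈-subsets (proj₁ X))
  ; point    = ⊥ , subst (_≤ 2) (sym (∣⊥∣≡0 m)) z≤n
  }

-- The chain lies below every element of P, equivalently below its minimum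
-- when P has one.
chainBelow : ℕ → FinitePoset → FinitePoset
chainBelow l P = record
  { poset    = ⊎-<-poset {d = 0ℓ} {e = 0ℓ} {f = 0ℓ} (Fin.≤-poset l) poset
  ; _≼?_     = ⊎-<-decidable Fin._≤?_ _≼?_
  ; elements = map inj₁ (allFin l) ++ map inj₂ elements
  ; complete = Enum.++⁺ (setoid (Fin l)) Eq.setoid
                 {xs = allFin l} {ys = elements} ∈-allFin complete
  ; point    = inj₂ point
  }
  where open FinitePoset P

{-# OPTIONS --safe #-}

-- Call a set independent for an additive map f : F₂ⁿ → F₂ᴺ if f kills none of its
-- nonempty subsets.  A random f kills a given nonempty set with probability 2⁻ᴺ, so
-- for N = ⌊n/2⌋ + 2 some f makes at least 3/4 of the sets in the L layers up to the
-- middle one independent.  For large n each of these layers has at least 2/3 of the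
-- size of the middle one, so these sets form a family of size at least L/2 times the
-- middle binomial coefficient.  It contains no weak copy of S₂ m: let A be the bottom
-- set of a copy.  Dividing F₂ᴺ by the span of A leaves dimension at most L + 1, and
-- each of the m sets B covering A in the copy has at most L - 1 elements outside A.
-- As any two of the sets B lie in a common independent set, each is determined by the
-- images of these elements, which leaves at most 2^((L + 1)(L - 1)) < m sets.

module Submission where

open import Defs
open import Data.Integer.Base as ℤ using (ℤ; ∣_∣)
open import Data.Nat.Base using (ℕ; _+_; _∸_; _^_; _≤_)
open import Data.Product.Base using (∃; _×_)
open import Data.Rational.Base using (0ℚ; _/_)

open import Data.Bool.Base using (Bool; true; false; not; _∧_; _xor_; if_then_else_; T)
import Data.Bool.Properties as Bool
open import Data.Fin.Base as Fin using (Fin; zero; suc; toℕ; fromℕ<; funToFin; finToFun)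
import Data.Fin.Properties as Fin
open import Data.Fin.Subset
  using (Subset; inside; outside; _∈_; _⊆_; ⊥; ⊤; ⁅_⁆; _─_; _∪_) renaming (∣_∣ to ∣_∣ˢ)
open import Data.Fin.Subset.Properties
open import Data.Integer.Base using (-[1+_]) renaming (+_ to pos)
import Data.Integer.Properties as ℤ
open import Data.List.Base as List using (List; length)
open import Data.List.Membership.Propositional using () renaming (_∈_ to _∈ˡ_)
open import Data.List.Membership.Propositional.Properties using (∈-map⁻; ∈-++⁻)
import Data.List.Properties as List
import Data.List.Relation.Unary.All as All
import Data.List.Relation.Unary.AllPairs as AllPairs
open import Data.List.Relation.Unary.Unique.Propositional using (Unique)
import Data.List.Relation.Unary.Unique.Propositional.Properties as Unique
open import Data.Nat.Base
  using (zero; suc; _*_; _<_; _<ᵇ_; _≡ᵇ_; z≤n; s≤s; ⌊_/2⌋; NonZero)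
open import Data.Nat.Combinatorics using (_C_; nC1≡n; nCk+nC[k+1]≡[n+1]C[k+1])
import Data.Nat.Properties as ℕ
open import Algebra.Properties.CommutativeSemigroup ℕ.+-commutativeSemigroup using (interchange)
open import Data.Nat.Tactic.RingSolver using (solve-∀)
open import Data.Product.Base using (_,_; proj₁; proj₂)
open import Data.Rational.Base as ℚ using (ℚ; ↥_; ↧ₙ_)
import Data.Rational.Properties as ℚ
import Data.Rational.Unnormalised.Base as ℚᵘ
import Data.Rational.Unnormalised.Properties as ℚᵘ
open import Data.Sum.Base as Sum using (_⊎_; inj₁; inj₂; [_,_]′)
open import Data.Sum.Relation.Binary.LeftOrder using (₁∼₁; ₁∼₂; ₂∼₂)
import Data.Sum.Relation.Binary.Pointwise as Pointwise
open import Data.Vec.Base using ([]; _∷_; here; there; zipWith; lookup; tabulate; _++_)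
import Data.Vec.Properties as Vec
open import Function.Base using (_∘_)
open import Function.Bundles using (Bijection)
open import Relation.Binary.PropositionalEquality
open import Relation.Nullary using (¬_; yes; no; contradiction)
open import Relation.Unary using () renaming (_⊆_ to _⊑_)

private
  variable
    n N : ℕ

-- Sums over all subsets

∑ : (Subset n → ℕ) → ℕ
∑ {zero}  f = f []
∑ {suc n} f = ∑ (f ∘ (outside ∷_)) + ∑ (f ∘ (inside ∷_))

∑-mono : {f g : Subset n → ℕ} → (∀ X → f X ≤ g X) → ∑ f ≤ ∑ g
∑-mono {zero}  f≤g = f≤g []
∑-mono {suc n} f≤g = ℕ.+-mono-≤ (∑-mono (f≤g ∘ (outside ∷_))) (∑-mono (f≤g ∘ (inside ∷_)))

∑-cong : {f g : Subset n → ℕ} → (∀ X → f X ≡ g X) → ∑ f ≡ ∑ g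
∑-cong f≗g = ℕ.≤-antisym (∑-mono (ℕ.≤-reflexive ∘ f≗g)) (∑-mono (ℕ.≤-reflexive ∘ sym ∘ f≗g))

∑-zero : ∑ {n} (λ _ → 0) ≡ 0
∑-zero {zero}  = refl
∑-zero {suc n} = cong₂ _+_ (∑-zero {n}) (∑-zero {n})

∑-distrib-+ : (f g : Subset n → ℕ) → ∑ (λ X → f X + g X) ≡ ∑ f + ∑ g
∑-distrib-+ {zero}  f g = refl
∑-distrib-+ {suc n} f g = trans
  (cong₂ _+_ (∑-distrib-+ (f ∘ (outside ∷_)) (g ∘ (outside ∷_)))
             (∑-distrib-+ (f ∘ (inside ∷_)) (g ∘ (inside ∷_))))
  (interchange (∑ (f ∘ (outside ∷_))) (∑ (g ∘ (outside ∷_)))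
               (∑ (f ∘ (inside ∷_))) (∑ (g ∘ (inside ∷_))))

∑-distribˡ-* : ∀ c (f : Subset n → ℕ) → ∑ (λ X → c * f X) ≡ c * ∑ f
∑-distribˡ-* {zero}  c f = refl
∑-distribˡ-* {suc n} c f = trans
  (cong₂ _+_ (∑-distribˡ-* c (f ∘ (outside ∷_))) (∑-distribˡ-* c (f ∘ (inside ∷_))))
  (sym (ℕ.*-distribˡ-+ c _ _))

∑-swap : ∀ {m} (f : Subset n → Subset m → ℕ) →
         ∑ (λ X → ∑ (λ Y → f X Y)) ≡ ∑ (λ Y → ∑ (λ X → f X Y))
∑-swap {zero}  f = refl
∑-swap {suc n} f = trans
  (cong₂ _+_ (∑-swap (f ∘ (outside ∷_))) (∑-swap (f ∘ (inside ∷_))))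
  (sym (∑-distrib-+ (λ Y → ∑ (λ X → f (outside ∷ X) Y)) (λ Y → ∑ (λ X → f (inside ∷ X) Y))))

term≤∑ : (f : Subset n → ℕ) → ∀ X → f X ≤ ∑ f
term≤∑ f []          = ℕ.≤-refl
term≤∑ f (false ∷ X) = ℕ.≤-trans (term≤∑ (f ∘ (outside ∷_)) X) (ℕ.m≤m+n _ _)
term≤∑ f (true ∷ X)  = ℕ.≤-trans (term≤∑ (f ∘ (inside ∷_)) X) (ℕ.m≤n+m _ _)

⟦_⟧ : Bool → ℕ
⟦ false ⟧ = 0
⟦ true  ⟧ = 1

⟦∧⟧ : ∀ a b → ⟦ a ∧ b ⟧ ≡ ⟦ a ⟧ * ⟦ b ⟧
⟦∧⟧ false b = refl
⟦∧⟧ true  b = sym (ℕ.+-identityʳ ⟦ b ⟧)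

-- Subsets as vectors over the two-element field

infixl 6 _⊕_

_⊕_ : Subset n → Subset n → Subset n
_⊕_ = zipWith _xor_

⊕-assoc : (X Y Z : Subset n) → (X ⊕ Y) ⊕ Z ≡ X ⊕ (Y ⊕ Z)
⊕-assoc = Vec.zipWith-assoc Bool.xor-assoc

⊕-identityˡ : (X : Subset n) → ⊥ ⊕ X ≡ X
⊕-identityˡ = Vec.zipWith-identityˡ Bool.xor-identityˡ

⊕-identityʳ : (X : Subset n) → X ⊕ ⊥ ≡ X
⊕-identityʳ = Vec.zipWith-identityʳ Bool.xor-identityʳ

⊕-self : (X : Subset n) → X ⊕ X ≡ ⊥
⊕-self []      = refl
⊕-self (x ∷ X) = cong₂ _∷_ (Bool.xor-same x) (⊕-self X)

⊕≡⊥⇒≡ : {X Y : Subset n} → X ⊕ Y ≡ ⊥ → X ≡ Y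
⊕≡⊥⇒≡ {X = X} {Y} eq = begin
  X            ≡⟨ ⊕-identityʳ X ⟨
  X ⊕ ⊥        ≡⟨ cong (X ⊕_) (⊕-self Y) ⟨
  X ⊕ (Y ⊕ Y)  ≡⟨ ⊕-assoc X Y Y ⟨
  X ⊕ Y ⊕ Y    ≡⟨ cong (_⊕ Y) eq ⟩
  ⊥ ⊕ Y        ≡⟨ ⊕-identityˡ Y ⟩
  Y            ∎
  where open ≡-Reasoning

∈-⊕⁻ : ∀ {x} (X Y : Subset n) → x ∈ X ⊕ Y → x ∈ X ⊎ x ∈ Y
∈-⊕⁻ (true  ∷ X) (false ∷ Y) here      = inj₁ here
∈-⊕⁻ (false ∷ X) (true  ∷ Y) here      = inj₂ here
∈-⊕⁻ (_     ∷ X) (_     ∷ Y) (there x) = Sum.map there there (∈-⊕⁻ X Y x)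

⊕-⊆ : {X Y Z : Subset n} → X ⊆ Z → Y ⊆ Z → X ⊕ Y ⊆ Z
⊕-⊆ {X = X} {Y} X⊆Z Y⊆Z x = [ X⊆Z , Y⊆Z ]′ (∈-⊕⁻ X Y x)

Additive : (Subset n → Subset N) → Set
Additive f = ∀ X Y → f (X ⊕ Y) ≡ f X ⊕ f Y

additive-⊥ : {f : Subset n → Subset N} → Additive f → f ⊥ ≡ ⊥
additive-⊥ {f = f} add = begin
  f ⊥          ≡⟨ cong f (⊕-self ⊥) ⟨
  f (⊥ ⊕ ⊥)    ≡⟨ add ⊥ ⊥ ⟩
  f ⊥ ⊕ f ⊥    ≡⟨ ⊕-self (f ⊥) ⟩
  ⊥            ∎
  where open ≡-Reasoning

-- The head is tested last, so that in `sample` the factor of the newest functional ends up next to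
-- the weight.
isEmpty : Subset n → Bool
isEmpty []      = true
isEmpty (b ∷ X) = isEmpty X ∧ not b

isEmpty-⊥ : ∀ n → isEmpty (⊥ {n}) ≡ true
isEmpty-⊥ zero    = refl
isEmpty-⊥ (suc n) = cong (_∧ true) (isEmpty-⊥ n)

isEmpty⇒⊥ : (X : Subset n) → isEmpty X ≡ true → X ≡ ⊥
isEmpty⇒⊥ []          _  = refl
isEmpty⇒⊥ (false ∷ X) eq = cong (false ∷_) (isEmpty⇒⊥ X (trans (sym (Bool.∧-identityʳ _)) eq))
isEmpty⇒⊥ (true ∷ X)  eq with () ← trans (sym eq) (Bool.∧-zeroʳ (isEmpty X))

-- Choosing an additive map that kills little weight

Halving : (Subset n → ℕ) → Set
Halving {n} w = ∃ λ (χ : Subset n → Bool) → (∀ X Y → χ (X ⊕ Y) ≡ χ X xor χ Y) ×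
                2 * ∑ (λ X → ⟦ not (χ X) ⟧ * w X) ≤ ∑ w

-- Some linear functional vanishes on at most half of any weight not charging ∅.
halve : (w : Subset n → ℕ) → w ⊥ ≡ 0 → Halving w
halve {zero}  w w⊥ = (λ _ → false) , (λ _ _ → refl) ,
  ℕ.≤-trans (ℕ.≤-reflexive (cong (λ v → 2 * (1 * v)) w⊥)) z≤n
halve {suc n} w w⊥ with halve (w ∘ (outside ∷_)) w⊥
-- The two extensions of `χ`, with value `r` on the new element, agree on sets without that element
-- and vanish on complementary parts of the rest. The lighter part is at most half of `∑ w₁`.
... | χ , χ-add , half = [ extend false , extend true ]′ (ℕ.≤-total even odd)
  where
  w₀ w₁ : Subset n → ℕ
  w₀ = w ∘ (outside ∷_)
  w₁ = w ∘ (inside ∷_)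

  weight : Bool → ℕ
  weight r = ∑ (λ X → ⟦ not (r xor χ X) ⟧ * w₁ X)

  even odd : ℕ
  even = weight false
  odd  = weight true

  even+odd : ∀ r → weight r + weight (not r) ≡ ∑ w₁
  even+odd r = trans
    (sym (∑-distrib-+ (λ X → ⟦ not (r xor χ X) ⟧ * w₁ X) (λ X → ⟦ not (not r xor χ X) ⟧ * w₁ X)))
    (∑-cong λ X → pointwise r (χ X) (w₁ X))
    where
    pointwise : ∀ r b v → ⟦ not (r xor b) ⟧ * v + ⟦ not (not r xor b) ⟧ * v ≡ v
    pointwise false false v = trans (ℕ.+-identityʳ _) (ℕ.+-identityʳ v)
    pointwise false true  v = ℕ.+-identityʳ v
    pointwise true  false v = ℕ.+-identityʳ v
    pointwise true  true  v = trans (ℕ.+-identityʳ _) (ℕ.+-identityʳ v)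

  extend : ∀ r → weight r ≤ weight (not r) → Halving w
  extend r lighter = χ⁺ , χ⁺-add , bound
    where
    χ⁺ : Subset (suc n) → Bool
    χ⁺ (b ∷ X) = (r ∧ b) xor χ X
    distrib : ∀ r a b c d → (r ∧ (a xor b)) xor (c xor d) ≡ ((r ∧ a) xor c) xor ((r ∧ b) xor d)
    distrib false a     b     c     d     = refl
    distrib true  false b     false d     = refl
    distrib true  false false true  d     = refl
    distrib true  false true  true  false = refl
    distrib true  false true  true  true  = refl
    distrib true  true  false false d     = refl
    distrib true  true  true  false false = refl
    distrib true  true  true  false true  = refl
    distrib true  true  false true  d     = Bool.not-involutive d
    distrib true  true  true  true  d     = refl
    χ⁺-add : ∀ X Y → χ⁺ (X ⊕ Y) ≡ χ⁺ X xor χ⁺ Y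
    χ⁺-add (a ∷ X) (b ∷ Y) rewrite χ-add X Y = distrib r a b (χ X) (χ Y)
    bound : 2 * ∑ (λ X → ⟦ not (χ⁺ X) ⟧ * w X) ≤ ∑ w
    bound = begin
      2 * (∑ (λ X → ⟦ not ((r ∧ false) xor χ X) ⟧ * w₀ X)
         + ∑ (λ X → ⟦ not ((r ∧ true) xor χ X) ⟧ * w₁ X))
        ≡⟨ cong₂ (λ a b → 2 * (∑ (λ X → ⟦ not (a xor χ X) ⟧ * w₀ X)
                             + ∑ (λ X → ⟦ not (b xor χ X) ⟧ * w₁ X)))
             (Bool.∧-zeroʳ r) (Bool.∧-identityʳ r) ⟩
      2 * (∑ (λ X → ⟦ not (χ X) ⟧ * w₀ X) + weight r)
        ≡⟨ ℕ.*-distribˡ-+ 2 (∑ (λ X → ⟦ not (χ X) ⟧ * w₀ X)) (weight r) ⟩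
      2 * ∑ (λ X → ⟦ not (χ X) ⟧ * w₀ X) + 2 * weight r
        ≤⟨ ℕ.+-mono-≤ half (begin
             2 * weight r                ≡⟨ cong (weight r +_) (ℕ.+-identityʳ _) ⟩
             weight r + weight r         ≤⟨ ℕ.+-monoʳ-≤ (weight r) lighter ⟩
             weight r + weight (not r)   ≡⟨ even+odd r ⟩
             ∑ w₁                        ∎) ⟩
      ∑ w ∎
      where open ℕ.≤-Reasoning

-- The random choice of `f` made greedily: each coordinate is a functional that halves the weight of
-- the sets killed by the coordinates chosen before it, so `N` coordinates leave at most a fraction
-- 2⁻ᴺ.
sample : ∀ N (w : Subset n → ℕ) → w ⊥ ≡ 0 →
         ∃ λ (f : Subset n → Subset N) → Additive f ×
         2 ^ N * ∑ (λ X → ⟦ isEmpty (f X) ⟧ * w X) ≤ ∑ w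
sample zero    w w⊥ = (λ _ → []) , (λ _ _ → refl) , ℕ.≤-reflexive
  (trans (ℕ.*-identityˡ _) (∑-cong λ X → ℕ.*-identityˡ (w X)))
sample (suc N) w w⊥ with halve w w⊥
... | χ , χ-add , half
  with sample N (λ X → ⟦ not (χ X) ⟧ * w X)
         (trans (cong (⟦ not (χ ⊥) ⟧ *_) w⊥) (ℕ.*-zeroʳ ⟦ not (χ ⊥) ⟧))
... | f , f-add , small = (λ X → χ X ∷ f X) , (λ X Y → cong₂ _∷_ (χ-add X Y) (f-add X Y)) , (begin
  2 * 2 ^ N * ∑ (λ X → ⟦ isEmpty (f X) ∧ not (χ X) ⟧ * w X)
    ≡⟨ cong (2 * 2 ^ N *_) (∑-cong λ X → trans
         (cong (_* w X) (⟦∧⟧ (isEmpty (f X)) (not (χ X)))) (ℕ.*-assoc ⟦ isEmpty (f X) ⟧ _ _)) ⟩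
  2 * 2 ^ N * ∑ (λ X → ⟦ isEmpty (f X) ⟧ * (⟦ not (χ X) ⟧ * w X))
    ≡⟨ ℕ.*-assoc 2 (2 ^ N) _ ⟩
  2 * (2 ^ N * ∑ (λ X → ⟦ isEmpty (f X) ⟧ * (⟦ not (χ X) ⟧ * w X)))
    ≤⟨ ℕ.*-monoʳ-≤ 2 small ⟩
  2 * ∑ (λ X → ⟦ not (χ X) ⟧ * w X)
    ≤⟨ half ⟩
  ∑ w ∎)
  where open ℕ.≤-Reasoning

-- Elimination

Collapse : Subset n → Set
Collapse {n} a = ∃ λ D → suc D ≡ n × ∃ λ (π : Subset n → Subset D) → Additive π ×
                 (∀ X → π X ≡ ⊥ → X ≡ ⊥ ⊎ X ≡ a)

-- Gaussian elimination with one vector: the first coordinate at which `a` is nonzero is the pivot.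
-- Adding `a` clears it where necessary, and then it is dropped.
collapse : (a : Subset n) → ¬ a ≡ ⊥ → Collapse a
collapse []          a≢⊥ = contradiction refl a≢⊥
collapse {suc n} (true ∷ a) _ = n , refl , π , π-add , kernel
  where
  π : Subset (suc n) → Subset n
  π (false ∷ X) = X
  π (true  ∷ X) = X ⊕ a
  ⊕-right : (X Y Z : Subset n) → (X ⊕ Y) ⊕ Z ≡ (X ⊕ Z) ⊕ Y
  ⊕-right X Y Z = trans (⊕-assoc X Y Z) (trans
    (cong (X ⊕_) (Vec.zipWith-comm Bool.xor-comm Y Z)) (sym (⊕-assoc X Z Y)))
  π-add : Additive π
  π-add (false ∷ X) (false ∷ Y) = refl
  π-add (false ∷ X) (true  ∷ Y) = ⊕-assoc X Y a
  π-add (true  ∷ X) (false ∷ Y) = ⊕-right X Y a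
  π-add (true  ∷ X) (true  ∷ Y) = sym (begin
    (X ⊕ a) ⊕ (Y ⊕ a)  ≡⟨ ⊕-assoc (X ⊕ a) Y a ⟨
    X ⊕ a ⊕ Y ⊕ a      ≡⟨ ⊕-right (X ⊕ a) Y a ⟩
    X ⊕ a ⊕ a ⊕ Y      ≡⟨ cong (_⊕ Y) (⊕-assoc X a a) ⟩
    X ⊕ (a ⊕ a) ⊕ Y    ≡⟨ cong (λ z → X ⊕ z ⊕ Y) (⊕-self a) ⟩
    X ⊕ ⊥ ⊕ Y          ≡⟨ cong (_⊕ Y) (⊕-identityʳ X) ⟩
    X ⊕ Y              ∎)
    where open ≡-Reasoning
  kernel : ∀ X → π X ≡ ⊥ → X ≡ ⊥ ⊎ X ≡ true ∷ a
  kernel (false ∷ X) eq = inj₁ (cong (false ∷_) eq)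
  kernel (true  ∷ X) eq = inj₂ (cong (true ∷_) (⊕≡⊥⇒≡ eq))
collapse (false ∷ a) a≢⊥ with collapse a (a≢⊥ ∘ cong (false ∷_))
... | D , refl , π , π-add , kernel = suc D , refl , π⁺ , π⁺-add , kernel⁺
  where
  π⁺ : Subset (suc (suc D)) → Subset (suc D)
  π⁺ (b ∷ X) = b ∷ π X
  π⁺-add : Additive π⁺
  π⁺-add (b ∷ X) (c ∷ Y) = cong (_ ∷_) (π-add X Y)
  kernel⁺ : ∀ X → π⁺ X ≡ ⊥ → X ≡ ⊥ ⊎ X ≡ false ∷ a
  kernel⁺ (b ∷ X) eq with refl ← Vec.∷-injectiveˡ eq =
    [ inj₁ ∘ cong (false ∷_) , inj₂ ∘ cong (false ∷_) ]′ (kernel X (Vec.∷-injectiveʳ eq))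

additive-∷ : {f : Subset (suc n) → Subset N} → Additive f →
             ∀ Z → f (true ∷ Z) ≡ f (true ∷ ⊥) ⊕ f (false ∷ Z)
additive-∷ {f = f} add Z =
  trans (cong (f ∘ (true ∷_)) (sym (⊕-identityˡ Z))) (add (true ∷ ⊥) (false ∷ Z))

Independent : (Subset n → Subset N) → Subset n → Set
Independent f A = ∀ {Z} → Z ⊆ A → f Z ≡ ⊥ → Z ≡ ⊥

Span : (Subset n → Subset N) → Subset n → Subset N → Set
Span f A x = ∃ λ Z → Z ⊆ A × f Z ≡ x

Quotient : (Subset n → Subset N) → Subset n → Set
Quotient {N = N} f A = ∃ λ D → D + ∣ A ∣ˢ ≡ N × ∃ λ (q : Subset N → Subset D) →
                       Additive q × (∀ x → q x ≡ ⊥ → Span f A x)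

-- Induction on `A`: `f` sends each further element to a vector outside the span so far, so
-- collapsing its image lowers the dimension by exactly one.
quotient : (f : Subset n → Subset N) → Additive f →
           (A : Subset n) → Independent f A → Quotient f A
quotient {N = N} f f-add [] indep =
  N , ℕ.+-identityʳ N , (λ x → x) , (λ _ _ → refl) , λ x x≡⊥ →
    [] , (λ ()) , trans (additive-⊥ f-add) (sym x≡⊥)
quotient f f-add (false ∷ A) indep
  with quotient (f ∘ (false ∷_)) (λ X Y → f-add (false ∷ X) (false ∷ Y)) A
         (λ Z⊆A eq → Vec.∷-injectiveʳ (indep (s⊆s Z⊆A) eq))
... | D , dim , q , q-add , kernel = D , dim , q , q-add , λ x eq → lift x (kernel x eq)
  where
  lift : ∀ x → Span (f ∘ (false ∷_)) A x → Span f (false ∷ A) x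
  lift x (Z , Z⊆A , fZ≡x) = false ∷ Z , s⊆s Z⊆A , fZ≡x
quotient {suc n} {N} f f-add (true ∷ A) indep
  with quotient (f ∘ (false ∷_)) (λ X Y → f-add (false ∷ X) (false ∷ Y)) A
         (λ Z⊆A eq → Vec.∷-injectiveʳ (indep (out⊆ Z⊆A) eq))
... | D , dim , q , q-add , kernel = divide (collapse (q v) v-survives)
  where
  v : Subset N
  v = f (true ∷ ⊥)

  -- Otherwise `v` would be the image of some `Z ⊆ A`, and `f` would kill the nonempty set
  -- `true ∷ Z`.
  v-survives : ¬ q v ≡ ⊥
  v-survives eq with kernel v eq
  ... | Z , Z⊆A , fZ≡v with () ← indep (s⊆s Z⊆A)
    (trans (additive-∷ f-add Z) (trans (cong (v ⊕_) fZ≡v) (⊕-self v)))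

  divide : Collapse (q v) → Quotient f (true ∷ A)
  divide (E , refl , π , π-add , π-kernel) =
    E , trans (ℕ.+-suc E ∣ A ∣ˢ) dim , π ∘ q
      , (λ X Y → trans (cong π (q-add X Y)) (π-add (q X) (q Y)))
      , λ x eq → [ old x , new x ]′ (π-kernel (q x) eq)
    where
    old : ∀ x → q x ≡ ⊥ → Span f (true ∷ A) x
    old x eq with kernel x eq
    ... | Z , Z⊆A , fZ≡x = false ∷ Z , out⊆ Z⊆A , fZ≡x
    -- Here `q` kills `v ⊕ x`; adding the new element to a witness for `v ⊕ x` gives a witness for
    -- `x`.
    new : ∀ x → q x ≡ q v → Span f (true ∷ A) x
    new x eq with kernel (v ⊕ x) (trans (q-add v x) (trans (cong (q v ⊕_) eq) (⊕-self (q v))))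
    ... | Z , Z⊆A , fZ≡v⊕x = true ∷ Z , s⊆s Z⊆A , (begin
      f (true ∷ Z)       ≡⟨ additive-∷ f-add Z ⟩
      v ⊕ f (false ∷ Z)  ≡⟨ cong (v ⊕_) fZ≡v⊕x ⟩
      v ⊕ (v ⊕ x)        ≡⟨ ⊕-assoc v v x ⟨
      v ⊕ v ⊕ x          ≡⟨ cong (_⊕ x) (⊕-self v) ⟩
      ⊥ ⊕ x              ≡⟨ ⊕-identityˡ x ⟩
      x                  ∎)
      where open ≡-Reasoning

-- Counting subsets by size

_⊆ᵇ_ : Subset n → Subset n → Bool
[]          ⊆ᵇ []      = true
(false ∷ X) ⊆ᵇ (_ ∷ Y) = X ⊆ᵇ Y
(true  ∷ X) ⊆ᵇ (y ∷ Y) = y ∧ X ⊆ᵇ Y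

⊆⇒⊆ᵇ : {X Y : Subset n} → X ⊆ Y → X ⊆ᵇ Y ≡ true
⊆⇒⊆ᵇ {X = []}        {[]}    X⊆Y = refl
⊆⇒⊆ᵇ {X = false ∷ X} {_ ∷ Y} X⊆Y = ⊆⇒⊆ᵇ (drop-∷-⊆ X⊆Y)
⊆⇒⊆ᵇ {X = true ∷ X}  {_ ∷ Y} X⊆Y with refl ← Vec.[]=⇒lookup (X⊆Y here) = ⊆⇒⊆ᵇ (drop-∷-⊆ X⊆Y)

∑-powerset : (Y : Subset n) → ∑ (λ X → ⟦ X ⊆ᵇ Y ⟧) ≡ 2 ^ ∣ Y ∣ˢ
∑-powerset []                  = refl
∑-powerset {suc n} (false ∷ Y) = trans (cong₂ _+_ (∑-powerset Y) (∑-zero {n})) (ℕ.+-identityʳ _)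
∑-powerset (true ∷ Y)          =
  cong₂ _+_ (∑-powerset Y) (trans (∑-powerset Y) (sym (ℕ.+-identityʳ _)))

∑-layer : ∀ n k → ∑ {n} (λ Y → ⟦ ∣ Y ∣ˢ ≡ᵇ k ⟧) ≡ n C k
∑-layer zero    zero    = refl
∑-layer zero    (suc k) = refl
∑-layer (suc n) zero    = trans (cong₂ _+_ (∑-layer n 0) (∑-zero {n})) refl
∑-layer (suc n) (suc k) = begin
  ∑ {n} (λ Y → ⟦ ∣ Y ∣ˢ ≡ᵇ suc k ⟧) + ∑ {n} (λ Y → ⟦ ∣ Y ∣ˢ ≡ᵇ k ⟧)
    ≡⟨ cong₂ _+_ (∑-layer n (suc k)) (∑-layer n k) ⟩
  n C suc k + n C k  ≡⟨ ℕ.+-comm (n C suc k) (n C k) ⟩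
  n C k + n C suc k  ≡⟨ nCk+nC[k+1]≡[n+1]C[k+1] n k ⟩
  suc n C suc k      ∎
  where open ≡-Reasoning

-- Windows of consecutive layers

window : ℕ → ℕ → ℕ → Bool
window zero    L s       = s <ᵇ L
window (suc a) L zero    = false
window (suc a) L (suc s) = window a L s

window-bounds : ∀ a L s → window a L s ≡ true → a ≤ s × s < a + L
window-bounds zero    L s       eq = z≤n , ℕ.<ᵇ⇒< s L (subst T (sym eq) _)
window-bounds (suc a) L (suc s) eq with window-bounds a L s eq
... | a≤s , s<a+L = s≤s a≤s , s≤s s<a+L

window-suc : ∀ a L s → ⟦ window a (suc L) s ⟧ ≡ ⟦ window a L s ⟧ + ⟦ s ≡ᵇ a + L ⟧
window-suc zero    zero    zero    = refl
window-suc zero    zero    (suc s) = refl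
window-suc zero    (suc L) zero    = refl
window-suc zero    (suc L) (suc s) = window-suc zero L s
window-suc (suc a) L       zero    = refl
window-suc (suc a) L       (suc s) = window-suc a L s

-- The lower bound `c / d` on a layer is kept as two numbers to stay within ℕ. Layers are split off
-- from the top by `window-suc`.
∑-window : ∀ n a L {c d} → (∀ j → j < L → c ≤ d * (n C (a + j))) →
           L * c ≤ d * ∑ {n} (λ Y → ⟦ window a L ∣ Y ∣ˢ ⟧)
∑-window n a zero            c≤ = z≤n
∑-window n a (suc L) {c} {d} c≤ = begin
  c + L * c
    ≤⟨ ℕ.+-mono-≤ (c≤ L ℕ.≤-refl) (∑-window n a L {d = d} (λ j j<L → c≤ j (ℕ.m<n⇒m<1+n j<L))) ⟩
  d * (n C (a + L)) + d * W
    ≡⟨ ℕ.+-comm (d * (n C (a + L))) (d * W) ⟩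
  d * W + d * (n C (a + L))
    ≡⟨ ℕ.*-distribˡ-+ d W (n C (a + L)) ⟨
  d * (W + (n C (a + L)))
    ≡⟨ cong (λ v → d * (W + v)) (∑-layer n (a + L)) ⟨
  d * (W + ∑ {n} (λ Y → ⟦ ∣ Y ∣ˢ ≡ᵇ a + L ⟧))
    ≡⟨ cong (d *_) (∑-distrib-+ {n} (λ Y → ⟦ window a L ∣ Y ∣ˢ ⟧) (λ Y → ⟦ ∣ Y ∣ˢ ≡ᵇ a + L ⟧)) ⟨
  d * ∑ {n} (λ Y → ⟦ window a L ∣ Y ∣ˢ ⟧ + ⟦ ∣ Y ∣ˢ ≡ᵇ a + L ⟧)
    ≡⟨ cong (d *_) (∑-cong {n} λ Y → window-suc a L ∣ Y ∣ˢ) ⟨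
  d * ∑ {n} (λ Y → ⟦ window a (suc L) ∣ Y ∣ˢ ⟧) ∎
  where
  open ℕ.≤-Reasoning
  W : ℕ
  W = ∑ {n} (λ Y → ⟦ window a L ∣ Y ∣ˢ ⟧)

-- Decidable families as lists

select : (Subset n → Bool) → List (Subset n)
select {zero}  p = if p [] then List.[ [] ] else List.[]
select {suc n} p = List.map (outside ∷_) (select (p ∘ (outside ∷_))) List.++
                   List.map (inside ∷_) (select (p ∘ (inside ∷_)))

∈-select⁻ : (p : Subset n → Bool) {X : Subset n} → X ∈ˡ select p → p X ≡ true
∈-select⁻ {zero} p {[]} X∈ with p []
∈-select⁻ {zero} p {[]} X∈ | true  = refl
∈-select⁻ {zero} p {[]} () | false
∈-select⁻ {suc n} p X∈ with ∈-++⁻ (List.map (outside ∷_) (select (p ∘ (outside ∷_)))) X∈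
... | inj₁ X∈₀ with Y , Y∈ , refl ← ∈-map⁻ (outside ∷_) X∈₀ = ∈-select⁻ (p ∘ (outside ∷_)) Y∈
... | inj₂ X∈₁ with Y , Y∈ , refl ← ∈-map⁻ (inside ∷_) X∈₁ = ∈-select⁻ (p ∘ (inside ∷_)) Y∈

select-unique : (p : Subset n → Bool) → Unique (select p)
select-unique {zero} p with p []
... | true  = All.[] AllPairs.∷ AllPairs.[]
... | false = AllPairs.[]
select-unique {suc n} p = Unique.++⁺
  (Unique.map⁺ Vec.∷-injectiveʳ (select-unique (p ∘ (outside ∷_))))
  (Unique.map⁺ Vec.∷-injectiveʳ (select-unique (p ∘ (inside ∷_))))
  λ (X∈₀ , X∈₁) → heads-differ (∈-map⁻ (outside ∷_) X∈₀) (∈-map⁻ (inside ∷_) X∈₁)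
  where
  heads-differ : ∀ {X xs ys} →
    (∃ λ Y → Y ∈ˡ xs × X ≡ outside ∷ Y) → ¬ (∃ λ Y → Y ∈ˡ ys × X ≡ inside ∷ Y)
  heads-differ (_ , _ , refl) (_ , _ , ())

length-select : (p : Subset n → Bool) → length (select p) ≡ ∑ (λ X → ⟦ p X ⟧)
length-select {zero} p with p []
... | true  = refl
... | false = refl
length-select {suc n} p = trans
  (List.length-++ (List.map (outside ∷_) (select (p ∘ (outside ∷_)))))
  (cong₂ _+_
    (trans (List.length-map (outside ∷_) (select (p ∘ (outside ∷_))))
           (length-select (p ∘ (outside ∷_))))
    (trans (List.length-map (inside ∷_) (select (p ∘ (inside ∷_))))
           (length-select (p ∘ (inside ∷_)))))

-- Binomial coefficients near the middle

-- This is (s + 1) C(n, s + 1) = (n - s) C(n, s), rearranged to avoid truncated subtraction.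
-- Pascal's rule reduces the case of `suc n` and `suc s` to those of `n` with `s` and with `suc s`.
absorption : ∀ n s → suc s * (n C suc s) + s * (n C s) ≡ n * (n C s)
absorption zero    zero    = refl
absorption zero    (suc s) = cong₂ _+_ (ℕ.*-zeroʳ (2 + s)) (ℕ.*-zeroʳ (1 + s))
absorption (suc n) zero    = trans (ℕ.+-identityʳ _) (trans (ℕ.*-identityˡ _)
  (trans (nC1≡n (suc n)) (sym (ℕ.*-identityʳ (suc n)))))
absorption (suc n) (suc s) = begin
  (2 + s) * (suc n C (2 + s)) + (1 + s) * (suc n C suc s)
    ≡⟨ cong₂ (λ x y → (2 + s) * x + (1 + s) * y)
         (nCk+nC[k+1]≡[n+1]C[k+1] n (suc s)) (nCk+nC[k+1]≡[n+1]C[k+1] n s) ⟨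
  (2 + s) * (c₁ + c₂) + (1 + s) * (c₀ + c₁)
    ≡⟨ regroup s c₀ c₁ c₂ ⟩
  ((2 + s) * c₂ + (1 + s) * c₁) + ((1 + s) * c₁ + s * c₀) + (c₀ + c₁)
    ≡⟨ cong₂ (λ x y → x + y + (c₀ + c₁)) (absorption n (suc s)) (absorption n s) ⟩
  n * c₁ + n * c₀ + (c₀ + c₁)
    ≡⟨ collect n c₀ c₁ ⟩
  suc n * (c₀ + c₁)
    ≡⟨ cong (suc n *_) (nCk+nC[k+1]≡[n+1]C[k+1] n s) ⟩
  suc n * (suc n C suc s) ∎
  where
  open ≡-Reasoning
  c₀ c₁ c₂ : ℕ
  c₀ = n C s
  c₁ = n C suc s
  c₂ = n C (2 + s)
  regroup : ∀ s x y z → (2 + s) * (y + z) + (1 + s) * (x + y) ≡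
            ((2 + s) * z + (1 + s) * y) + ((1 + s) * y + s * x) + (x + y)
  regroup = solve-∀
  collect : ∀ n x y → n * y + n * x + (x + y) ≡ suc n * (x + y)
  collect = solve-∀

-- By `absorption` the ratio of the two coefficients is (n - s) / (s + 1), which `n≤` bounds by 1 +
-- 2i / (s + 1) and `small` then by 1 + 1/x.
C-step : ∀ x i s n → 2 * (x * i) ≤ suc s → n ≤ suc (2 * (s + i)) →
         x * (n C suc s) ≤ suc x * (n C s)
C-step x i s n small n≤ = ℕ.*-cancelˡ-≤ (suc s) (ℕ.+-cancelʳ-≤ (x * (s * b)) _ _ (begin
  suc s * (x * c) + x * (s * b)       ≡⟨ factor x s b c ⟩
  x * (suc s * c + s * b)             ≡⟨ cong (x *_) (absorption n s) ⟩
  x * (n * b)                         ≤⟨ ℕ.*-monoʳ-≤ x (ℕ.*-monoˡ-≤ b n≤) ⟩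
  x * (suc (2 * (s + i)) * b)         ≡⟨ expand x s i b ⟩
  2 * (x * i) * b + (x * suc s * b + x * (s * b))
    ≤⟨ ℕ.+-monoˡ-≤ _ (ℕ.*-monoˡ-≤ b small) ⟩
  suc s * b + (x * suc s * b + x * (s * b))
    ≡⟨ refold x s b ⟩
  suc s * (suc x * b) + x * (s * b)   ∎))
  where
  open ℕ.≤-Reasoning
  b c : ℕ
  b = n C s
  c = n C suc s
  factor : ∀ x s b c → suc s * (x * c) + x * (s * b) ≡ x * (suc s * c + s * b)
  factor = solve-∀
  expand : ∀ x s i b → x * (suc (2 * (s + i)) * b) ≡ 2 * (x * i) * b + (x * suc s * b + x * (s * b))
  expand = solve-∀
  refold : ∀ x s b → suc s * b + (x * suc s * b + x * (s * b)) ≡ suc s * (suc x * b) + x * (s * b)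
  refold = solve-∀

-- Each step up from layer `s` costs a factor (x + 1) / x. Letting x run from t + i - 1 down to t
-- makes the product telescope to (t + i) / t.
C-near-middle : ∀ t i s n → 2 * ((t + i) * i) ≤ suc s → n ≤ suc (2 * (s + i)) →
                t * (n C (s + i)) ≤ (t + i) * (n C s)
C-near-middle t zero s n _ _ = ℕ.≤-reflexive (cong₂ (λ x y → x * (n C y))
  (sym (ℕ.+-identityʳ t)) (ℕ.+-identityʳ s))
C-near-middle t (suc i) s n small n≤ = begin
  t * (n C (s + suc i))
    ≡⟨ cong (λ v → t * (n C v)) (ℕ.+-suc s i) ⟩
  t * (n C (suc s + i))
    ≤⟨ C-near-middle t i (suc s) n
         (ℕ.≤-trans (ℕ.*-monoʳ-≤ 2 (ℕ.*-mono-≤ t+i≤ (ℕ.n≤1+n i))) (ℕ.m≤n⇒m≤1+n small))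
         (subst (λ v → n ≤ suc (2 * v)) (ℕ.+-suc s i) n≤) ⟩
  (t + i) * (n C suc s)
    ≤⟨ C-step (t + i) (suc i) s n (ℕ.≤-trans (ℕ.*-monoʳ-≤ 2 (ℕ.*-monoˡ-≤ (suc i) t+i≤)) small) n≤ ⟩
  suc (t + i) * (n C s)
    ≡⟨ cong (_* (n C s)) (ℕ.+-suc t i) ⟨
  (t + suc i) * (n C s) ∎
  where
  open ℕ.≤-Reasoning
  t+i≤ : t + i ≤ t + suc i
  t+i≤ = ℕ.+-monoʳ-≤ t (ℕ.n≤1+n i)

-- Independent sets in a window of layers

-- The number of nonempty subsets of `Y` killed by `f`. As a number rather than a truth value it can
-- be averaged.
dependencies : (Subset n → Subset N) → Subset n → ℕ
dependencies f Y = ∑ λ Z → ⟦ Z ⊆ᵇ Y ⟧ * (⟦ isEmpty (f Z) ⟧ * ⟦ not (isEmpty Z) ⟧)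

good : (Subset n → Subset N) → ℕ → ℕ → Subset n → Bool
good f a L Y = window a L ∣ Y ∣ˢ ∧ (dependencies f Y ≡ᵇ 0)

good-bounds : (f : Subset n → Subset N) → ∀ a L {Y} → good f a L Y ≡ true →
              a ≤ ∣ Y ∣ˢ × ∣ Y ∣ˢ < a + L
good-bounds f a L {Y} eq = window-bounds a L ∣ Y ∣ˢ (Bool.∧-conicalˡ _ _ eq)

good-independent : (f : Subset n → Subset N) → ∀ a L {Y} → good f a L Y ≡ true →
                   Independent f Y
good-independent {N = N} f a L {Y} eq {Z} Z⊆Y fZ≡⊥ with isEmpty Z in Z≟⊥
... | true  = isEmpty⇒⊥ Z Z≟⊥
... | false = contradiction (begin
  1  ≡⟨ cong₂ _*_ (cong ⟦_⟧ (⊆⇒⊆ᵇ Z⊆Y)) (cong₂ _*_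
          (cong ⟦_⟧ (trans (cong isEmpty fZ≡⊥) (isEmpty-⊥ N)))
          (cong (⟦_⟧ ∘ not) Z≟⊥)) ⟨
  ⟦ Z ⊆ᵇ Y ⟧ * (⟦ isEmpty (f Z) ⟧ * ⟦ not (isEmpty Z) ⟧)
     ≤⟨ term≤∑ (λ Z → ⟦ Z ⊆ᵇ Y ⟧ * (⟦ isEmpty (f Z) ⟧ * ⟦ not (isEmpty Z) ⟧)) Z ⟩
  dependencies f Y
     ≡⟨ ℕ.≡ᵇ⇒≡ _ 0 (subst T (sym (Bool.∧-conicalʳ (window a L ∣ Y ∣ˢ) _ eq)) _) ⟩
  0  ∎) λ()
  where open ℕ.≤-Reasoning

-- Summed over the sets killed by `f`, this weight counts the pairs of a window set and a dependency
-- inside it. The first factor gives the hypothesis on ∅ in `sample`.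
upWeight : ℕ → ℕ → Subset n → ℕ
upWeight a L Z = ⟦ not (isEmpty Z) ⟧ * ∑ (λ Y → ⟦ window a L ∣ Y ∣ˢ ⟧ * ⟦ Z ⊆ᵇ Y ⟧)

upWeight-⊥ : ∀ n a L → upWeight a L (⊥ {n}) ≡ 0
upWeight-⊥ n a L rewrite isEmpty-⊥ n = refl

-- First moment method: the dependencies of all window sets together number at most a quarter of the
-- window, and each window set that is not good has at least one.
many-good : ∀ n a L → ∃ λ (f : Subset n → Subset (suc (a + L))) → Additive f ×
            3 * ∑ {n} (λ Y → ⟦ window a L ∣ Y ∣ˢ ⟧) ≤ 4 * ∑ (λ Y → ⟦ good f a L Y ⟧)
many-good n a L with sample (suc (a + L)) (upWeight a L) (upWeight-⊥ n a L)
... | f , f-add , sampled = f , f-add , ℕ.+-cancelˡ-≤ W _ _ (begin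
  W + 3 * W                    ≤⟨ ℕ.*-monoʳ-≤ 4 W≤G+E ⟩
  4 * (G + E)                  ≡⟨ ℕ.*-distribˡ-+ 4 G E ⟩
  4 * G + 4 * E                ≡⟨ ℕ.+-comm (4 * G) (4 * E) ⟩
  4 * E + 4 * G                ≤⟨ ℕ.+-monoˡ-≤ (4 * G) 4E≤W ⟩
  W + 4 * G                    ∎)
  where
  open ℕ.≤-Reasoning
  win : Subset n → ℕ
  win Y = ⟦ window a L ∣ Y ∣ˢ ⟧
  W G E : ℕ
  W = ∑ win
  G = ∑ (λ Y → ⟦ good f a L Y ⟧)
  E = ∑ (λ Y → win Y * dependencies f Y)
  w : Subset n → ℕ
  w = upWeight a L

  split : ∀ b d → ⟦ b ⟧ ≤ ⟦ b ∧ (d ≡ᵇ 0) ⟧ + ⟦ b ⟧ * d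
  split false d       = z≤n
  split true  zero    = s≤s z≤n
  split true  (suc d) = s≤s z≤n

  W≤G+E : W ≤ G + E
  W≤G+E = ℕ.≤-trans (∑-mono λ Y → split (window a L ∣ Y ∣ˢ) (dependencies f Y))
    (ℕ.≤-reflexive (∑-distrib-+ (λ Y → ⟦ good f a L Y ⟧) (λ Y → win Y * dependencies f Y)))

  -- Double counting: the dependencies of window sets are regrouped by killed set, each counted with
  -- its supersets in the window.
  E≡ : E ≡ ∑ (λ Z → ⟦ isEmpty (f Z) ⟧ * w Z)
  E≡ = begin-equality
    E
      ≡⟨ ∑-cong (λ Y → ∑-distribˡ-* (win Y)
           (λ Z → ⟦ Z ⊆ᵇ Y ⟧ * (⟦ isEmpty (f Z) ⟧ * ⟦ not (isEmpty Z) ⟧))) ⟨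
    ∑ (λ Y → ∑ (λ Z → win Y * (⟦ Z ⊆ᵇ Y ⟧ * (⟦ isEmpty (f Z) ⟧ * ⟦ not (isEmpty Z) ⟧))))
      ≡⟨ ∑-swap (λ Y Z → win Y * (⟦ Z ⊆ᵇ Y ⟧ * (⟦ isEmpty (f Z) ⟧ * ⟦ not (isEmpty Z) ⟧))) ⟩
    ∑ (λ Z → ∑ (λ Y → win Y * (⟦ Z ⊆ᵇ Y ⟧ * (⟦ isEmpty (f Z) ⟧ * ⟦ not (isEmpty Z) ⟧))))
      ≡⟨ ∑-cong (λ Z → trans
           (∑-cong λ Y → rearrange (win Y) ⟦ Z ⊆ᵇ Y ⟧ ⟦ isEmpty (f Z) ⟧ ⟦ not (isEmpty Z) ⟧)
           (trans
             (∑-distribˡ-* ⟦ isEmpty (f Z) ⟧ (λ Y → ⟦ not (isEmpty Z) ⟧ * (win Y * ⟦ Z ⊆ᵇ Y ⟧)))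
             (cong (⟦ isEmpty (f Z) ⟧ *_)
               (∑-distribˡ-* ⟦ not (isEmpty Z) ⟧ (λ Y → win Y * ⟦ Z ⊆ᵇ Y ⟧))))) ⟩
    ∑ (λ Z → ⟦ isEmpty (f Z) ⟧ * w Z) ∎
    where
    rearrange : ∀ x y z t → x * (y * (z * t)) ≡ z * (t * (x * y))
    rearrange = solve-∀

  not-le : ∀ b v → ⟦ not b ⟧ * v ≤ v
  not-le true  v = z≤n
  not-le false v = ℕ.≤-reflexive (ℕ.+-identityʳ v)

  -- A window set has at most a + L - 1 elements, two fewer than the dimension `suc (a + L)` of the
  -- target; this gap yields the factor 4.
  layer-bound : ∀ Y → 4 * (win Y * 2 ^ ∣ Y ∣ˢ) ≤ 2 ^ suc (a + L) * win Y
  layer-bound Y with window a L ∣ Y ∣ˢ in eq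
  ... | false = z≤n
  ... | true  = begin
    4 * (1 * 2 ^ ∣ Y ∣ˢ)      ≡⟨ cong (4 *_) (ℕ.*-identityˡ (2 ^ ∣ Y ∣ˢ)) ⟩
    4 * 2 ^ ∣ Y ∣ˢ            ≡⟨ ℕ.*-assoc 2 2 (2 ^ ∣ Y ∣ˢ) ⟩
    2 ^ (2 + ∣ Y ∣ˢ)          ≤⟨ ℕ.^-monoʳ-≤ 2 (s≤s (proj₂ (window-bounds a L _ eq))) ⟩
    2 ^ suc (a + L)           ≡⟨ ℕ.*-identityʳ _ ⟨
    2 ^ suc (a + L) * 1       ∎

  4E≤W : 4 * E ≤ W
  4E≤W = ℕ.*-cancelˡ-≤ (2 ^ suc (a + L)) {{ℕ.m^n≢0 2 (suc (a + L))}} (begin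
    2 ^ suc (a + L) * (4 * E)
      ≡⟨ swap (2 ^ suc (a + L)) 4 E ⟩
    4 * (2 ^ suc (a + L) * E)
      ≡⟨ cong (λ v → 4 * (2 ^ suc (a + L) * v)) E≡ ⟩
    4 * (2 ^ suc (a + L) * ∑ (λ Z → ⟦ isEmpty (f Z) ⟧ * w Z))
      ≤⟨ ℕ.*-monoʳ-≤ 4 sampled ⟩
    4 * ∑ w
      ≤⟨ ℕ.*-monoʳ-≤ 4 (∑-mono λ Z → not-le (isEmpty Z) (∑ (λ Y → win Y * ⟦ Z ⊆ᵇ Y ⟧))) ⟩
    4 * ∑ (λ Z → ∑ (λ Y → win Y * ⟦ Z ⊆ᵇ Y ⟧))
      ≡⟨ cong (4 *_) (∑-swap (λ Z Y → win Y * ⟦ Z ⊆ᵇ Y ⟧)) ⟩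
    4 * ∑ (λ Y → ∑ (λ Z → win Y * ⟦ Z ⊆ᵇ Y ⟧))
      ≡⟨ cong (4 *_) (∑-cong λ Y → trans (∑-distribˡ-* (win Y) (λ Z → ⟦ Z ⊆ᵇ Y ⟧))
           (cong (win Y *_) (∑-powerset Y))) ⟩
    4 * ∑ (λ Y → win Y * 2 ^ ∣ Y ∣ˢ)
      ≡⟨ ∑-distribˡ-* 4 (λ Y → win Y * 2 ^ ∣ Y ∣ˢ) ⟨
    ∑ (λ Y → 4 * (win Y * 2 ^ ∣ Y ∣ˢ))
      ≤⟨ ∑-mono layer-bound ⟩
    ∑ (λ Y → 2 ^ suc (a + L) * win Y)
      ≡⟨ ∑-distribˡ-* (2 ^ suc (a + L)) win ⟩
    2 ^ suc (a + L) * W ∎)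
    where
    swap : ∀ x y z → x * (y * z) ≡ y * (x * z)
    swap = solve-∀

-- Stars in families of independent sets

-- The singletons of `X` listed in exactly `l` slots, so that lists for different sets can be
-- compared slot by slot. `atoms` fills spare slots with ∅, which keeps every entry inside `X`.
Atoms : ℕ → Subset n → Set
Atoms {n} l X = ∃ λ (g : Fin l → Subset n) →
                (∀ t → g t ⊆ X) × (∀ {x} → x ∈ X → ∃ λ t → g t ≡ ⁅ x ⁆)

atoms : ∀ l (X : Subset n) → ∣ X ∣ˢ ≤ l → Atoms l X
atoms l []          _ = (λ _ → []) , (λ _ ()) , λ ()
atoms l (false ∷ X) ≤l with atoms l X ≤l
... | g , g⊆ , cover = (λ t → false ∷ g t) , (λ t → out⊆ (g⊆ t)) ,
  λ { (there x∈X) → let t , eq = cover x∈X in t , cong (false ∷_) eq }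
atoms {suc n} (suc l) (true ∷ X) (s≤s ≤l) with atoms l X ≤l
... | g , g⊆ , cover = g⁺ , g⁺⊆ , cover⁺
  where
  g⁺ : Fin (suc l) → Subset (suc n)
  g⁺ zero    = true ∷ ⊥
  g⁺ (suc t) = false ∷ g t
  g⁺⊆ : ∀ t → g⁺ t ⊆ true ∷ X
  g⁺⊆ zero    = s⊆s ⊥⊆
  g⁺⊆ (suc t) = out⊆ (g⊆ t)
  cover⁺ : ∀ {x} → x ∈ true ∷ X → ∃ λ t → g⁺ t ≡ ⁅ x ⁆
  cover⁺ here        = zero , refl
  cover⁺ (there x∈X) = let t , eq = cover x∈X in suc t , cong (false ∷_) eq

∣─∣ : (X A : Subset n) → A ⊆ X → ∣ X ─ A ∣ˢ + ∣ A ∣ˢ ≡ ∣ X ∣ˢ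
∣─∣ []          []          _   = refl
∣─∣ (false ∷ X) (false ∷ A) A⊆X = ∣─∣ X A (drop-∷-⊆ A⊆X)
∣─∣ (true ∷ X)  (false ∷ A) A⊆X = cong suc (∣─∣ X A (drop-∷-⊆ A⊆X))
∣─∣ (true ∷ X)  (true ∷ A)  A⊆X = trans (ℕ.+-suc _ _) (cong suc (∣─∣ X A (drop-∷-⊆ A⊆X)))
∣─∣ (false ∷ X) (true ∷ A)  A⊆X with () ← A⊆X here

funToFin-injective : ∀ {k b} (f g : Fin k → Fin b) → funToFin f ≡ funToFin g → ∀ i → f i ≡ g i
funToFin-injective f g eq i = begin
  f i                       ≡⟨ Fin.finToFun-funToFin f i ⟨
  finToFun (funToFin f) i   ≡⟨ cong (λ c → finToFun c i) eq ⟩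
  finToFun (funToFin g) i   ≡⟨ Fin.finToFun-funToFin g i ⟩
  g i                       ∎
  where open ≡-Reasoning

bit : Bool → Fin 2
bit false = zero
bit true  = suc zero

bit-injective : ∀ {a b} → bit a ≡ bit b → a ≡ b
bit-injective {false} {false} _ = refl
bit-injective {true}  {true}  _ = refl

code : Subset n → Fin (2 ^ n)
code X = funToFin (bit ∘ lookup X)

code-injective : (X Y : Subset n) → code X ≡ code Y → X ≡ Y
code-injective X Y eq = begin
  X                          ≡⟨ Vec.tabulate∘lookup X ⟨
  tabulate (lookup X)        ≡⟨ Vec.tabulate-cong (bit-injective ∘ funToFin-injective _ _ eq) ⟩
  tabulate (lookup Y)        ≡⟨ Vec.tabulate∘lookup Y ⟩
  Y                          ∎
  where open ≡-Reasoning

-- The images under q ∘ f of the points of B i ─ A determine B i: if x ∈ B i and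
-- q (f ⁅ x ⁆) = q (f W) with W ⊆ B j, then f kills ⁅ x ⁆ ⊕ W ⊕ Z for some Z ⊆ A,
-- so ⁅ x ⁆ = W ⊕ Z ⊆ B j.
star-bound : (f : Subset n → Subset N) → Additive f → ∀ {a l m} → N ≤ l + 2 + a →
             (A : Subset n) → Independent f A → a ≤ ∣ A ∣ˢ →
             (B : Fin m → Subset n) → (∀ {i j} → B i ≡ B j → i ≡ j) →
             (∀ i → A ⊆ B i) → (∀ i → ∣ B i ∣ˢ ≤ l + a) →
             (∀ i j → ∃ λ U → B i ⊆ U × B j ⊆ U × Independent f U) →
             m ≤ 2 ^ ((l + 2) * l)
star-bound {n} {N} f f-add {a} {l} {m} N≤ A A-indep a≤ B B-inj A⊆B B≤ joins
  with quotient f f-add A A-indep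
... | D , dim , q , q-add , kernel = ℕ.≮⇒≥ crowded
  where
  D≤ : D ≤ l + 2
  D≤ = ℕ.+-cancelʳ-≤ a D (l + 2) (begin
    D + a          ≤⟨ ℕ.+-monoʳ-≤ D a≤ ⟩
    D + ∣ A ∣ˢ     ≡⟨ dim ⟩
    N              ≤⟨ N≤ ⟩
    l + 2 + a      ∎)
    where open ℕ.≤-Reasoning

  few : ∀ i → ∣ B i ─ A ∣ˢ ≤ l
  few i = ℕ.+-cancelʳ-≤ a _ l (begin
    ∣ B i ─ A ∣ˢ + a         ≤⟨ ℕ.+-monoʳ-≤ _ a≤ ⟩
    ∣ B i ─ A ∣ˢ + ∣ A ∣ˢ    ≡⟨ ∣─∣ (B i) A (A⊆B i) ⟩
    ∣ B i ∣ˢ                 ≤⟨ B≤ i ⟩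
    l + a                    ∎)
    where open ℕ.≤-Reasoning

  pieces : ∀ i → Atoms l (B i ─ A)
  pieces i = atoms l (B i ─ A) (few i)

  -- One of `2 ^ D` vectors in each of `l` slots, with `D ≤ l + 2`: the source of the exponent in
  -- the bound.
  signature : Fin m → Fin ((2 ^ D) ^ l)
  signature i = funToFin (λ t → code (q (f (proj₁ (pieces i) t))))

  absorbed : ∀ i j {x} → x ∈ B i → ∀ {W} → W ⊆ B j → q (f ⁅ x ⁆) ≡ q (f W) → x ∈ B j
  absorbed i j {x} x∈ {W} W⊆ eq with kernel (f ⁅ x ⁆ ⊕ f W)
    (trans (q-add (f ⁅ x ⁆) (f W)) (trans (cong (_⊕ q (f W)) eq) (⊕-self (q (f W)))))
  -- Independence must be applied inside a single set; `U` contains `⁅ x ⁆`, `W` and `Z` at once.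
  ... | Z , Z⊆A , fZ≡ with joins i j
  ... | U , Bi⊆U , Bj⊆U , U-indep = [ W⊆ , A⊆B j ∘ Z⊆A ]′ (∈-⊕⁻ W Z (subst (x ∈_) x≡W⊕Z (x∈⁅x⁆ x)))
    where
    x⊆U : ⁅ x ⁆ ⊆ U
    x⊆U y∈ with refl ← x∈⁅y⁆⇒x≡y x y∈ = Bi⊆U x∈
    x≡W⊕Z : ⁅ x ⁆ ≡ W ⊕ Z
    x≡W⊕Z = ⊕≡⊥⇒≡ (U-indep (⊕-⊆ x⊆U (⊕-⊆ (Bj⊆U ∘ W⊆) (Bj⊆U ∘ A⊆B j ∘ Z⊆A))) (begin
      f (⁅ x ⁆ ⊕ (W ⊕ Z))              ≡⟨ cong f (⊕-assoc ⁅ x ⁆ W Z) ⟨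
      f (⁅ x ⁆ ⊕ W ⊕ Z)                ≡⟨ f-add (⁅ x ⁆ ⊕ W) Z ⟩
      f (⁅ x ⁆ ⊕ W) ⊕ f Z              ≡⟨ cong₂ _⊕_ (f-add ⁅ x ⁆ W) fZ≡ ⟩
      f ⁅ x ⁆ ⊕ f W ⊕ (f ⁅ x ⁆ ⊕ f W)  ≡⟨ ⊕-self (f ⁅ x ⁆ ⊕ f W) ⟩
      ⊥                                ∎))
      where open ≡-Reasoning

  signature-⊆ : ∀ i j → signature i ≡ signature j → B i ⊆ B j
  signature-⊆ i j eq {x} x∈ with x ∈? A
  ... | yes x∈A = A⊆B j x∈A
  ... | no  x∉A with proj₂ (proj₂ (pieces i)) (x∈p∧x∉q⇒x∈p─q x∈ x∉A)
  ... | t , atom≡x = absorbed i j x∈ (p─q⊆p (B j) A ∘ proj₁ (proj₂ (pieces j)) t)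
    (trans (cong (q ∘ f) (sym atom≡x))
           (code-injective _ _ (funToFin-injective _ _ eq t)))

  crowded : ¬ 2 ^ ((l + 2) * l) < m
  crowded bound with Fin.pigeonhole (ℕ.≤-<-trans (begin
    (2 ^ D) ^ l           ≡⟨ ℕ.^-*-assoc 2 D l ⟩
    2 ^ (D * l)           ≤⟨ ℕ.^-monoʳ-≤ 2 (ℕ.*-monoˡ-≤ l D≤) ⟩
    2 ^ ((l + 2) * l)     ∎) bound) signature
    where open ℕ.≤-Reasoning
  ... | i , j , i<j , eq = Fin.<⇒≢ i<j (B-inj
    (⊆-antisym (signature-⊆ i j eq) (signature-⊆ j i (sym eq))))

-- Copies of S₂ with a chain below

module Copy {P : FinitePoset} {F G : Family n} (G⊑F : G ⊑ F) (copy : WeakCopy P G) where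
  open FinitePoset P
  open WeakCopy copy using (ψ; monotone) public

  image : Carrier → Subset n
  image p = proj₁ (Bijection.to ψ p)

  image-∈ : ∀ p → F (image p)
  image-∈ p = G⊑F (proj₂ (Bijection.to ψ p))

  image-injective : ∀ {p p′} → image p ≡ image p′ → p ≈ p′
  image-injective = Bijection.injective ψ

⊆∧≢⇒∣∣< : {X Y : Subset n} → X ⊆ Y → ¬ X ≡ Y → ∣ X ∣ˢ < ∣ Y ∣ˢ
⊆∧≢⇒∣∣< {X = []}        {[]}        X⊆Y X≢Y = contradiction refl X≢Y
⊆∧≢⇒∣∣< {X = false ∷ X} {false ∷ Y} X⊆Y X≢Y = ⊆∧≢⇒∣∣< (drop-∷-⊆ X⊆Y) (X≢Y ∘ cong (false ∷_))
⊆∧≢⇒∣∣< {X = false ∷ X} {true ∷ Y}  X⊆Y X≢Y = s≤s (p⊆q⇒∣p∣≤∣q∣ (drop-∷-⊆ X⊆Y))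
⊆∧≢⇒∣∣< {X = true ∷ X}  {true ∷ Y}  X⊆Y X≢Y = s≤s (⊆∧≢⇒∣∣< (drop-∷-⊆ X⊆Y) (X≢Y ∘ cong (true ∷_)))
⊆∧≢⇒∣∣< {X = true ∷ X}  {false ∷ Y} X⊆Y X≢Y with () ← X⊆Y here

∣∪∣≤ : (X Y : Subset n) → ∣ X ∪ Y ∣ˢ ≤ ∣ X ∣ˢ + ∣ Y ∣ˢ
∣∪∣≤ []          []          = z≤n
∣∪∣≤ (false ∷ X) (false ∷ Y) = ∣∪∣≤ X Y
∣∪∣≤ (false ∷ X) (true ∷ Y)  = ℕ.≤-trans (s≤s (∣∪∣≤ X Y)) (ℕ.≤-reflexive (sym (ℕ.+-suc _ _)))
∣∪∣≤ (true ∷ X)  (false ∷ Y) = s≤s (∣∪∣≤ X Y)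
∣∪∣≤ (true ∷ X)  (true ∷ Y)  = s≤s (ℕ.≤-trans (∣∪∣≤ X Y) (ℕ.+-monoʳ-≤ ∣ X ∣ˢ (ℕ.n≤1+n _)))

module _ (c m : ℕ) where

  S₂⁺ : FinitePoset
  S₂⁺ = chainBelow c (S₂ m)

  open FinitePoset S₂⁺ using (Carrier; _≈_; _≼_)

  bottom : Carrier
  bottom = inj₂ (⊥ , ℕ.≤-trans (ℕ.≤-reflexive (∣⊥∣≡0 m)) z≤n)

  point : Fin m → Carrier
  point i = inj₂ (⁅ i ⁆ , ℕ.≤-trans (ℕ.≤-reflexive (∣⁅x⁆∣≡1 i)) (s≤s z≤n))

  pair : Fin m → Fin m → Carrier
  pair i j = inj₂ (⁅ i ⁆ ∪ ⁅ j ⁆ , ℕ.≤-trans (∣∪∣≤ ⁅ i ⁆ ⁅ j ⁆)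
    (ℕ.≤-reflexive (cong₂ _+_ (∣⁅x⁆∣≡1 i) (∣⁅x⁆∣≡1 j))))

  bottom≼point : ∀ i → bottom ≼ point i
  bottom≼point i = ₂∼₂ ⊥⊆

  point≼pairˡ : ∀ i j → point i ≼ pair i j
  point≼pairˡ i j = ₂∼₂ (p⊆p∪q ⁅ j ⁆)

  point≼pairʳ : ∀ i j → point j ≼ pair i j
  point≼pairʳ i j = ₂∼₂ (q⊆p∪q ⁅ i ⁆ ⁅ j ⁆)

  point-injective : ∀ {i j} → point i ≈ point j → i ≡ j
  point-injective {i} {j} (Pointwise.inj₂ eq) = x∈⁅y⁆⇒x≡y j (subst (i ∈_) eq (x∈⁅x⁆ i))

  -- The images of ∅, of the singletons and of their unions in pairs serve as `A`, the sets `B i`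
  -- and the common supersets in `star-bound`.
  independent-free : (f : Subset n → Subset N) → Additive f → ∀ {a l} → N ≤ l + 2 + a →
                     2 ^ ((l + 2) * l) < m → {F : Family n} →
                     (∀ {Y} → F Y → a ≤ ∣ Y ∣ˢ × ∣ Y ∣ˢ ≤ l + a × Independent f Y) →
                     WeakFree S₂⁺ F
  independent-free f f-add N≤ m> F-props (G , G⊑F , copy) = ℕ.<⇒≱ m>
    (star-bound f f-add N≤ (image bottom) (proj₂ (proj₂ (props bottom))) (proj₁ (props bottom))
      (image ∘ point) (point-injective ∘ image-injective)
      (λ i → monotone (bottom≼point i)) (λ i → proj₁ (proj₂ (props (point i))))
      (λ i j → image (pair i j) , monotone (point≼pairˡ i j) , monotone (point≼pairʳ i j) ,
               proj₂ (proj₂ (props (pair i j)))))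
    where
    open Copy G⊑F copy
    props : ∀ p → _
    props p = F-props (image-∈ p)

-- The value of e

chain-height : ∀ c s {top} (g : Fin c → ℕ) → (∀ i → s ≤ g i) →
               (∀ {i j} → i Fin.< j → g i < g j) → (∀ i → g i < top) → s ≤ top → s + c ≤ top
chain-height zero    s g s≤g g-mono g<top s≤top =
  ℕ.≤-trans (ℕ.≤-reflexive (ℕ.+-identityʳ s)) s≤top
chain-height (suc c) s g s≤g g-mono g<top s≤top = ℕ.≤-trans (ℕ.≤-reflexive (ℕ.+-suc s c))
  (chain-height c (suc s) (g ∘ suc) (λ i → ℕ.≤-<-trans (s≤g zero) (g-mono (s≤s z≤n)))
    (g-mono ∘ s≤s) (g<top ∘ suc) (ℕ.≤-<-trans (s≤g zero) (g<top zero)))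

-- The adjoined chain, ∅, a singleton and a pair form a chain of c + 3 elements. Their images have
-- strictly increasing sizes, too many for c + 2 layers. Writing the ground set as `2 + m` supplies
-- two distinct points.
layers-free : ∀ c m n s → WeakFree (chainBelow c (S₂ (2 + m))) (Layers n s (c + 2))
layers-free c m n s (G , G⊑F , copy) = ℕ.<⇒≱ (proj₂ (in-layers (pair c M zero (suc zero)))) (begin
  s + (c + 2)                              ≡⟨ ℕ.+-assoc s c 2 ⟨
  s + c + 2                                ≡⟨ ℕ.+-comm (s + c) 2 ⟩
  2 + (s + c)                              ≤⟨ s≤s (s≤s above-chain) ⟩
  2 + height (bottom c M)                  ≤⟨ s≤s (climb (bottom≼point c M zero) bottom≉point) ⟩
  1 + height (point c M zero)              ≤⟨ climb (point≼pairˡ c M zero (suc zero)) point≉pair ⟩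
  height (pair c M zero (suc zero))        ∎)
  where
  open ℕ.≤-Reasoning
  open Copy G⊑F copy
  M : ℕ
  M = 2 + m
  open FinitePoset (S₂⁺ c M) using (Carrier; _≈_; _≼_)
  bottom≉point : ¬ bottom c M ≈ point c M zero
  bottom≉point (Pointwise.inj₂ ())
  point≉pair : ¬ point c M zero ≈ pair c M zero (suc zero)
  point≉pair (Pointwise.inj₂ ())
  height : Carrier → ℕ
  height p = ∣ image p ∣ˢ
  climb : ∀ {p p′} → p ≼ p′ → ¬ p ≈ p′ → height p < height p′
  climb p≼p′ p≉p′ = ⊆∧≢⇒∣∣< (monotone p≼p′) (p≉p′ ∘ image-injective)
  in-layers : ∀ p → s ≤ height p × height p < s + (c + 2)
  in-layers p with i , eq ← image-∈ p rewrite eq =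
    ℕ.m≤m+n s (toℕ i) , ℕ.+-monoʳ-< s (Fin.toℕ<n i)
  above-chain : s + c ≤ height (bottom c M)
  above-chain = chain-height c s (height ∘ inj₁) (proj₁ ∘ in-layers ∘ inj₁)
    (λ i<j → climb (₁∼₁ (ℕ.<⇒≤ i<j)) λ { (Pointwise.inj₁ i≡j) → Fin.<⇒≢ i<j i≡j })
    (λ i → climb ₁∼₂ λ ()) (proj₁ (in-layers (bottom c M)))

module _ {P : FinitePoset} {F : Family n} where
  open FinitePoset P

  embed : (φ : Carrier → Subset n) → (∀ {p p′} → p ≼ p′ → φ p ⊆ φ p′) →
          (∀ {p p′} → φ p ≡ φ p′ → p ≈ p′) → (∀ p → F (φ p)) → ¬ WeakFree P F
  embed φ φ-mono φ-inj φ∈F free = free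
    ((λ X → ∃ λ p → φ p ≡ X) , (λ { (p , refl) → φ∈F p }) , record
      { ψ = record
        { to        = λ p → φ p , p , refl
        ; cong      = φ-cong
        ; bijective = φ-inj , λ { (_ , p , eq) → p , λ z≈p → trans (φ-cong z≈p) eq }
        }
      ; monotone = φ-mono
      })
    where
    φ-cong : ∀ {p p′} → p ≈ p′ → φ p ≡ φ p′
    φ-cong p≈p′ = ⊆-antisym (φ-mono (reflexive p≈p′)) (φ-mono (reflexive (Eq.sym p≈p′)))

++-⊆ : ∀ {k} {X X′ : Subset k} {Y Y′ : Subset n} → X ⊆ X′ → Y ⊆ Y′ → X ++ Y ⊆ X′ ++ Y′
++-⊆ {X = []}        {[]}         X⊆ Y⊆ = Y⊆
++-⊆ {X = false ∷ X} {_ ∷ X′}     X⊆ Y⊆ = out⊆ (++-⊆ (drop-∷-⊆ X⊆) Y⊆)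
++-⊆ {X = true ∷ X}  {true ∷ X′}  X⊆ Y⊆ = s⊆s (++-⊆ (drop-∷-⊆ X⊆) Y⊆)
++-⊆ {X = true ∷ X}  {false ∷ X′} X⊆ Y⊆ with () ← X⊆ here

∣++∣ : ∀ {k} (X : Subset k) (Y : Subset n) → ∣ X ++ Y ∣ˢ ≡ ∣ X ∣ˢ + ∣ Y ∣ˢ
∣++∣ []          Y = refl
∣++∣ (false ∷ X) Y = ∣++∣ X Y
∣++∣ (true ∷ X)  Y = cong suc (∣++∣ X Y)

-- The first `toℕ i` points. As `i` ranges over `Fin n`, the full set never occurs, which keeps the
-- chain apart from the image of ∅ in `layers-not-free`.
initial : Fin n → Subset n
initial zero    = ⊥
initial (suc i) = true ∷ initial i

∣initial∣ : (i : Fin n) → ∣ initial i ∣ˢ ≡ toℕ i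
∣initial∣ {n} zero = ∣⊥∣≡0 n
∣initial∣ (suc i)  = cong suc (∣initial∣ i)

initial-mono : {i j : Fin n} → i Fin.≤ j → initial i ⊆ initial j
initial-mono {i = zero}          _         = ⊥⊆
initial-mono {i = suc i} {suc j} (s≤s i≤j) = s⊆s (initial-mono i≤j)

-- The chain goes to initial segments of a block of `c` points, and `S₂ m` to a second block on top
-- of the full first one; all sizes are at most c + 2. A third block of `w` points stays empty and
-- makes the cube large enough to have `w` layers.
layers-not-free : ∀ c m w → c + 2 < w → ¬ WeakFree (chainBelow c (S₂ m)) (Layers (c + (m + w)) 0 w)
layers-not-free c m w c+2<w = embed {P = S₂⁺ c m} φ φ-mono φ-inj φ∈
  where
  open FinitePoset (S₂⁺ c m) using (Carrier; _≈_; _≼_)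
  φ : Carrier → Subset (c + (m + w))
  φ (inj₁ i)       = initial i ++ ⊥
  φ (inj₂ (X , _)) = ⊤ {c} ++ (X ++ ⊥ {w})
  φ-mono : ∀ {p p′} → p ≼ p′ → φ p ⊆ φ p′
  φ-mono (₁∼₂ {i}) = ++-⊆ {X = initial i} ⊆⊤ ⊥⊆
  φ-mono (₁∼₁ i≤j) = ++-⊆ (initial-mono i≤j) ⊆-refl
  φ-mono (₂∼₂ X⊆Y) = ++-⊆ {X = ⊤ {c}} ⊆-refl (++-⊆ X⊆Y ⊆-refl)
  ⊤≢initial : ∀ i {Y Z : Subset (m + w)} → ¬ ⊤ ++ Y ≡ initial i ++ Z
  ⊤≢initial i eq = ℕ.<⇒≢ (Fin.toℕ<n i) (trans (sym (∣initial∣ i))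
    (trans (cong ∣_∣ˢ (sym (Vec.++-injectiveˡ ⊤ (initial i) eq))) (∣⊤∣≡n c)))
  φ-inj : ∀ {p p′} → φ p ≡ φ p′ → p ≈ p′
  φ-inj {inj₁ i} {inj₁ j} eq = Pointwise.inj₁ (Fin.toℕ-injective
    (trans (sym (∣initial∣ i)) (trans
      (cong ∣_∣ˢ (Vec.++-injectiveˡ (initial i) (initial j) eq)) (∣initial∣ j))))
  φ-inj {inj₁ i} {inj₂ X} eq = contradiction (sym eq) (⊤≢initial i)
  φ-inj {inj₂ X} {inj₁ i} eq = contradiction eq (⊤≢initial i)
  φ-inj {inj₂ (X , _)} {inj₂ (Y , _)} eq = Pointwise.inj₂
    (Vec.++-injectiveˡ X Y (Vec.++-injectiveʳ (⊤ {c}) ⊤ eq))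
  ∣φ∣ : ∀ p → ∣ φ p ∣ˢ ≤ c + 2
  ∣φ∣ (inj₁ i) = begin
    ∣ initial i ++ ⊥ {m + w} ∣ˢ             ≡⟨ ∣++∣ (initial i) ⊥ ⟩
    ∣ initial i ∣ˢ + ∣ ⊥ {m + w} ∣ˢ         ≡⟨ cong₂ _+_ (∣initial∣ i) (∣⊥∣≡0 (m + w)) ⟩
    toℕ i + 0                       ≤⟨ ℕ.+-mono-≤ (ℕ.<⇒≤ (Fin.toℕ<n i)) z≤n ⟩
    c + 2                           ∎
    where open ℕ.≤-Reasoning
  ∣φ∣ (inj₂ (X , X≤2)) = begin
    ∣ ⊤ {c} ++ (X ++ ⊥ {w}) ∣ˢ          ≡⟨ ∣++∣ (⊤ {c}) (X ++ ⊥) ⟩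
    ∣ ⊤ {c} ∣ˢ + ∣ X ++ ⊥ {w} ∣ˢ        ≡⟨ cong₂ _+_ (∣⊤∣≡n c) (∣++∣ X ⊥) ⟩
    c + (∣ X ∣ˢ + ∣ ⊥ {w} ∣ˢ)           ≡⟨ cong (λ v → c + (∣ X ∣ˢ + v)) (∣⊥∣≡0 w) ⟩
    c + (∣ X ∣ˢ + 0)                ≡⟨ cong (c +_) (ℕ.+-identityʳ ∣ X ∣ˢ) ⟩
    c + ∣ X ∣ˢ                      ≤⟨ ℕ.+-monoʳ-≤ c X≤2 ⟩
    c + 2                           ∎
    where open ℕ.≤-Reasoning
  φ∈ : ∀ p → Layers (c + (m + w)) 0 w (φ p)
  φ∈ p = fromℕ< (ℕ.≤-<-trans (∣φ∣ p) c+2<w) , sym (Fin.toℕ-fromℕ< _)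

e-chainBelow-S₂ : ∀ c m → e chainBelow c (S₂ (2 + m)) is (c + 2)
e-chainBelow-S₂ c m = (λ n s _ → layers-free c m n s) , λ w all-free → ℕ.≮⇒≥ λ c+2<w →
  layers-not-free c (2 + m) w c+2<w (all-free _ 0
    (ℕ.m≤n⇒m≤1+n (ℕ.≤-trans (ℕ.m≤n+m w (2 + m)) (ℕ.m≤n+m _ c))))

-- Lower bound for La

n≤1+2⌊n/2⌋ : ∀ n → n ≤ suc (2 * ⌊ n /2⌋)
n≤1+2⌊n/2⌋ zero          = z≤n
n≤1+2⌊n/2⌋ (suc zero)    = ℕ.≤-refl
n≤1+2⌊n/2⌋ (suc (suc n)) = s≤s (ℕ.≤-trans (s≤s (n≤1+2⌊n/2⌋ n))
  (ℕ.≤-reflexive (cong suc (sym (ℕ.+-suc ⌊ n /2⌋ (⌊ n /2⌋ + 0))))))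

-- An upper bound for 2 (t + i) i, the quantity required to be small in `C-near-middle`, at t = 2L
-- and i ≤ L.
threshold : ℕ → ℕ
threshold L = 2 * ((2 * L + L) * L)

-- Taking t = 2L in `C-near-middle`, a layer at distance i ≤ L below the middle is smaller by a
-- factor of at most (2L + L) / 2L = 3/2.
central-layers : ∀ n l j → l + threshold (suc l) ≤ ⌊ n /2⌋ → j < suc l →
                 2 * (n C ⌊ n /2⌋) ≤ 3 * (n C (⌊ n /2⌋ ∸ l + j))
central-layers n l j large (s≤s j≤l) = ℕ.*-cancelˡ-≤ L (begin
  L * (2 * (n C h))            ≡⟨ comm L (n C h) ⟩
  2 * L * (n C h)              ≡⟨ cong (λ v → 2 * L * (n C v)) s+i≡h ⟨
  2 * L * (n C (s + i))        ≤⟨ C-near-middle (2 * L) i s n small n≤ ⟩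
  (2 * L + i) * (n C s)        ≤⟨ ℕ.*-monoˡ-≤ (n C s) (ℕ.+-monoʳ-≤ (2 * L) i≤L) ⟩
  (2 * L + L) * (n C s)        ≡⟨ triple L (n C s) ⟩
  L * (3 * (n C s))            ∎)
  where
  open ℕ.≤-Reasoning
  L h s i : ℕ
  L = suc l
  h = ⌊ n /2⌋
  s = h ∸ l + j
  i = l ∸ j
  i≤L : i ≤ L
  i≤L = ℕ.m≤n⇒m≤1+n (ℕ.m∸n≤m l j)
  s+i≡h : s + i ≡ h
  s+i≡h = trans (ℕ.+-assoc (h ∸ l) j i)
    (trans (cong (λ v → h ∸ l + v) (ℕ.m+[n∸m]≡n j≤l)) (ℕ.m∸n+n≡m (ℕ.m+n≤o⇒m≤o l large)))
  small : 2 * ((2 * L + i) * i) ≤ suc s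
  small = begin
    2 * ((2 * L + i) * i)   ≤⟨ ℕ.*-monoʳ-≤ 2 (ℕ.*-mono-≤ (ℕ.+-monoʳ-≤ (2 * L) i≤L) i≤L) ⟩
    threshold L             ≤⟨ ℕ.m+n≤o⇒m≤o∸n (threshold L) (subst (_≤ h) (ℕ.+-comm l _) large) ⟩
    h ∸ l                   ≤⟨ ℕ.m≤m+n (h ∸ l) j ⟩
    s                       ≤⟨ ℕ.n≤1+n s ⟩
    suc s                   ∎
  n≤ : n ≤ suc (2 * (s + i))
  n≤ = subst (λ v → n ≤ suc (2 * v)) (sym s+i≡h) (n≤1+2⌊n/2⌋ n)
  comm : ∀ x y → x * (2 * y) ≡ 2 * x * y
  comm = solve-∀
  triple : ∀ x y → (2 * x + x) * y ≡ x * (3 * y)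
  triple = solve-∀

good-free : ∀ c m l a (f : Subset n → Subset (suc (a + suc l))) → Additive f →
            2 ^ ((l + 2) * l) < m →
            WeakFree (chainBelow c (S₂ m)) (_∈ˡ select (good f a (suc l)))
good-free c m l a f f-add m> = independent-free c m f f-add (ℕ.≤-reflexive (dims a l)) m>
  λ {Y} Y∈ → props Y (∈-select⁻ (good f a (suc l)) Y∈)
  where
  dims : ∀ a l → suc (a + suc l) ≡ l + 2 + a
  dims = solve-∀
  props : ∀ Y → good f a (suc l) Y ≡ true → a ≤ ∣ Y ∣ˢ × ∣ Y ∣ˢ ≤ l + a × Independent f Y
  props Y is-good with good-bounds f a (suc l) is-good
  ... | a≤ , <a+L = a≤
    , ℕ.≤-pred (subst (suc ∣ Y ∣ˢ ≤_) (trans (ℕ.+-suc a l) (cong suc (ℕ.+-comm a l))) <a+L)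
    , good-independent f a (suc l) is-good

-- Each of the `L = suc l` layers has at least 2/3 of the middle size, and at least 3/4 of their
-- sets are good; the product is L/2.
good-large : ∀ n l (let a = ⌊ n /2⌋ ∸ l) (f : Subset n → Subset (suc (a + suc l))) →
             l + threshold (suc l) ≤ ⌊ n /2⌋ →
             3 * ∑ {n} (λ Y → ⟦ window a (suc l) ∣ Y ∣ˢ ⟧) ≤ 4 * ∑ (λ Y → ⟦ good f a (suc l) Y ⟧) →
             suc l * (2 * (n C ⌊ n /2⌋)) ≤ 4 * length (select (good f a (suc l)))
good-large n l f large dense = begin
  suc l * (2 * (n C ⌊ n /2⌋))
    ≤⟨ ∑-window n a (suc l) {2 * (n C ⌊ n /2⌋)} {3} (λ j → central-layers n l j large) ⟩
  3 * ∑ {n} (λ Y → ⟦ window a (suc l) ∣ Y ∣ˢ ⟧)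
    ≤⟨ dense ⟩
  4 * ∑ (λ Y → ⟦ good f a (suc l) Y ⟧)
    ≡⟨ cong (4 *_) (length-select (good f a (suc l))) ⟨
  4 * length (select (good f a (suc l))) ∎
  where
  open ℕ.≤-Reasoning
  a : ℕ
  a = ⌊ n /2⌋ ∸ l

many-independent : ∀ c m n l → 2 ^ ((l + 2) * l) < m → l + threshold (suc l) ≤ ⌊ n /2⌋ →
                   ∃ λ v → IsFreeSize (chainBelow c (S₂ m)) n v × suc l * (2 * (n C ⌊ n /2⌋)) ≤ 4 * v
many-independent c m n l m> large =
  let a                 = ⌊ n /2⌋ ∸ l
      f , f-add , dense = many-good n a (suc l)
      family            = select (good f a (suc l))
  in length family , (family , select-unique (good f a (suc l)) , good-free c m l a f f-add m> , refl)
   , good-large n l f large dense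

La-lower : ∀ c m n l → 2 ^ ((l + 2) * l) < m → l + threshold (suc l) ≤ ⌊ n /2⌋ →
           suc l * (n C ⌊ n /2⌋) ≤ La n (chainBelow c (S₂ m)) * 2
La-lower c m n l m> large =
  let v , free , 2Lc≤4v = many-independent c m n l m> large
  in ℕ.≤-trans (halved (suc l) (n C ⌊ n /2⌋) v 2Lc≤4v)
       (ℕ.*-monoˡ-≤ 2 (proj₂ (La-isMaximum n (chainBelow c (S₂ m))) v free))
  where
  halved : ∀ x y v → x * (2 * y) ≤ 4 * v → x * y ≤ v * 2
  halved x y v le = ℕ.*-cancelˡ-≤ 2 (subst₂ _≤_ (comm x y) (regroup v) le)
    where
    comm : ∀ x y → x * (2 * y) ≡ 2 * (x * y)
    comm = solve-∀
    regroup : ∀ v → 4 * v ≡ 2 * (v * 2)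
    regroup = solve-∀

-- Fractions, the limit inferior and the choice of L

/-mono-≤ : ∀ i j c d .{{_ : NonZero c}} .{{_ : NonZero d}} →
           i ℤ.* pos d ℤ.≤ j ℤ.* pos c → i / c ℚ.≤ j / d
/-mono-≤ i j (suc c) (suc d) le = ℚ.toℚᵘ-cancel-≤ (begin
  ℚ.toℚᵘ (i / suc c)  ≃⟨ ℚ.toℚᵘ-fromℚᵘ (ℚᵘ.mkℚᵘ i c) ⟩
  ℚᵘ.mkℚᵘ i c         ≤⟨ ℚᵘ.*≤* le ⟩
  ℚᵘ.mkℚᵘ j d         ≃⟨ ℚ.toℚᵘ-fromℚᵘ (ℚᵘ.mkℚᵘ j d) ⟨
  ℚ.toℚᵘ (j / suc d)  ∎)
  where open ℚᵘ.≤-Reasoning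

/-mono-< : ∀ i j c d .{{_ : NonZero c}} .{{_ : NonZero d}} →
           i ℤ.* pos d ℤ.< j ℤ.* pos c → i / c ℚ.< j / d
/-mono-< i j (suc c) (suc d) lt = ℚ.toℚᵘ-cancel-< (begin-strict
  ℚ.toℚᵘ (i / suc c)  ≃⟨ ℚ.toℚᵘ-fromℚᵘ (ℚᵘ.mkℚᵘ i c) ⟩
  ℚᵘ.mkℚᵘ i c         <⟨ ℚᵘ.*<* lt ⟩
  ℚᵘ.mkℚᵘ j d         ≃⟨ ℚ.toℚᵘ-fromℚᵘ (ℚᵘ.mkℚᵘ j d) ⟨
  ℚ.toℚᵘ (j / suc d)  ∎)
  where open ℚᵘ.≤-Reasoning

ratio-lower : ∀ c m n l → 2 ^ ((l + 2) * l) < m → l + threshold (suc l) ≤ ⌊ n /2⌋ →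
              pos (suc l) / 2 ℚ.≤ ratio (chainBelow c (S₂ m)) n
ratio-lower c m n l m> large =
  /-mono-≤ (pos (suc l)) (pos (La n P′)) 2 (n C ⌊ n /2⌋) {{_}} {{nCk-nonZero (ℕ.⌊n/2⌋≤n n)}}
    (subst₂ ℤ._≤_ (ℤ.pos-* (suc l) (n C ⌊ n /2⌋)) (ℤ.pos-* (La n P′) 2)
    (ℤ.+≤+ (La-lower c m n l m> large)))
  where
  P′ : FinitePoset
  P′ = chainBelow c (S₂ m)

π⁻-lower : ∀ c m l (K : ℝ) → 2 ^ ((l + 2) * l) < m → K ℝ< (pos (suc l) / 2) →
           K <ₗ π⁻ (chainBelow c (S₂ m))
π⁻-lower c m l K m> K<L/2 =
  let p , p<L/2 , K<p = ℝ.upper-rounded K K<L/2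
  -- The limit inferior must exceed a rational strictly above `K`, so `p` is placed strictly between
  -- `K` and L/2. From `n ≥ t + t` follows `⌊ n /2⌋ ≥ t`.
  in p , K<p , pos (suc l) / 2 , p<L/2 , t + t , λ n n≥ →
     ratio-lower c m n l m> (subst (_≤ ⌊ n /2⌋) (sym (ℕ.n≡⌊n+n/2⌋ t)) (ℕ.⌊n/2⌋-mono n≥))
  where
  t : ℕ
  t = l + threshold (suc l)

-- Half of the chosen integer is one more than the absolute value of the numerator of `q`, hence
-- more than `q`.
half-above : ∀ q → ∃ λ L → q ℚ.< L / 2
half-above q = pos (2 * suc ∣ ↥ q ∣) , subst (ℚ._< pos (2 * suc ∣ ↥ q ∣) / 2) (ℚ.↥p/↧p≡p q)
  (/-mono-< (↥ q) (pos (2 * suc ∣ ↥ q ∣)) (↧ₙ q) 2 (bound (↥ q) (↧ₙ q)))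
  where
  bound : ∀ i d .{{_ : NonZero d}} → i ℤ.* pos 2 ℤ.< pos (2 * suc ∣ i ∣) ℤ.* pos d
  bound (pos n)      d = subst₂ ℤ._<_ (ℤ.pos-* n 2) (ℤ.pos-* (2 * suc n) d) (ℤ.+<+ (begin-strict
    n * 2              ≡⟨ ℕ.*-comm n 2 ⟩
    2 * n              <⟨ ℕ.*-monoʳ-< 2 (ℕ.n<1+n n) ⟩
    2 * suc n          ≤⟨ ℕ.m≤m*n (2 * suc n) d ⟩
    2 * suc n * d      ∎))
    where open ℕ.≤-Reasoning
  bound (-[1+ n ]) (suc d) = ℤ.-<+

explicit-poset : (k : ℕ) → 3 ≤ k → (K : ℝ) → 0ℚ <ℝ K → (L : ℤ) → K ℝ< (L / 2) →
                 let P = chainBelow (k ∸ 2) (S₂ (2 ^ (∣ L ∣ ^ 2) + 1)) in (e P is k) × (K <ₗ π⁻ P)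
-- An integer L ≤ 0 would put L/2 above the positive `K`, so that 0 would lie in both cuts.
explicit-poset k 3≤k K 0<K (pos zero)    K<L/2 = contradiction (0<K , K<L/2) (ℝ.disjoint K)
explicit-poset k 3≤k K 0<K (-[1+ n ])    K<L/2 = contradiction
  (0<K , ℝ.upper-closed K (/-mono-< -[1+ n ] (pos 0) 2 1 ℤ.-<+) K<L/2) (ℝ.disjoint K)
explicit-poset k 3≤k K 0<K (pos (suc l)) K<L/2 =
    subst₂ (λ m k′ → e chainBelow (k ∸ 2) (S₂ m) is k′) 2+≡m (ℕ.m∸n+n≡m (ℕ.<⇒≤ 3≤k))
      (e-chainBelow-S₂ (k ∸ 2) (M ∸ 1))
  , π⁻-lower (k ∸ 2) (M + 1) l K m> K<L/2
  where
  M : ℕ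
  M = 2 ^ (suc l ^ 2)
  2+≡m : 2 + (M ∸ 1) ≡ M + 1
  2+≡m = trans (cong suc (ℕ.m+[n∸m]≡n (ℕ.m^n>0 2 (suc l ^ 2)))) (ℕ.+-comm 1 M)
  -- With L = l + 1 the exponent (l + 2) l of `star-bound` is L² - 1, below the exponent L² in `M`.
  square : ∀ l → suc ((l + 2) * l) ≡ suc l * (suc l * 1)
  square = solve-∀
  m> : 2 ^ ((l + 2) * l) < M + 1
  m> = ℕ.≤-<-trans (ℕ.^-monoʳ-≤ 2 (ℕ.≤-trans (ℕ.n≤1+n _) (ℕ.≤-reflexive (square l))))
    (ℕ.m<m+n M (s≤s z≤n))

mainTheorem5 :
    (k : ℕ) → 3 ≤ k → (K : ℝ) → 0ℚ <ℝ K →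
    (∃ λ (P : FinitePoset) → (e P is k) × (K <ₗ π⁻ P)) ×
    -- K < L / 2 is L > 2K
    ((L : ℤ) → K ℝ< (L / 2) →
     let m = 2 ^ (∣ L ∣ ^ 2) + 1
         P = chainBelow (k ∸ 2) (S₂ m)
     in (e P is k) × (K <ₗ π⁻ P))
-- Existence is the explicit statement at an L for which L/2 exceeds some rational in the upper cut
-- of `K`.
mainTheorem5 k 3≤k K 0<K = (_ , explicit L K<L/2) , explicit
  where
  explicit = explicit-poset k 3≤k K 0<K
  q : ℚ
  q = proj₁ (ℝ.upper-inhab K)
  L : ℤ
  L = proj₁ (half-above q)
  K<L/2 : K ℝ< (L / 2)
  K<L/2 = ℝ.upper-closed K (proj₂ (half-above q)) (proj₂ (ℝ.upper-inhab K))
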